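{- Let $P$ be a minuscule poset. Then $\sum_{p\in P}\mathbb{1}_p\equiv \frac{\#P}{2}$.
   Context: Minuscule posets are the posets attached to a simple Lie algebra (Dynkin diagram) together with a minuscule node (the poset of join-irreducible elements of the corresponding minuscule weight lattice / Bruhat order on $W/W_J$). Up to isomorphism they are: the rectangles $[a]\times[b]$ (product order); the shifted staircases $\{(i,j)\colon1\le i\le j\le n\}$ with componentwise order; the double-tailed diamonds $d_n(1)$ for $n\ge2$, consisting of a chain $x_1<\dots<x_{n-1}$, two incomparable elements $y_1,y_2$, and a chain $z_{n-1}<\dots<z_1$ with $x_i<y_j<z_k$ for all $i,j,k$; and the two exceptional minuscule posets $\Lambda_{E_6}$ (16 elements) and $\Lambda_{E_7}$ (27 elements) of types $E_6$ and $E_7$. $\mathcal{J}(P)$ is the set of order ideals of $P$. For $x\in P$, $I\in\mathcal{J}(P)$: $\mathbb{1}_x(I)=1$ if $x\in I$, else $0$; $T_x^+(I)=1$ if $x$ is a minimal element of $P\setminus I$, else $0$; $T_x^-(I)=1$ if $x$ is a maximal element of $I$, else $0$; $T_x=T_x^+-T_x^-$. For $f,g\colon\mathcal{J}(P)\to\mathbb{R}$, $f\equiv g$ means $f-g=\sum_{x\in P}c_xT_x$ for some real constants $c_x$; a real number denotes the corresponding constant function. -}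

module Defs where

open import Algebra.Apartness.Bundles using (HeytingField)
open import Algebra.Bundles using (CommutativeRing)
import Algebra.Definitions.RawMonoid as RawMonoidDefs
open import Data.Bool.Base using (if_then_else_)
open import Data.Fin.Base as Fin using (Fin)
open import Data.Fin using (#_)
import Data.Fin.Properties as Fin
open import Data.List.Base using (List; []; _∷_; map)
open import Data.Nat.Base as ℕ using (ℕ; NonZero; nonZero)
open import Data.Nat.ListAction using (sum)
import Data.Nat.Properties as ℕ
open import Data.Product.Base using (Σ-syntax; ∃-syntax; _×_; _,_; proj₁; proj₂)
open import Data.Product.Relation.Binary.Pointwise.NonDependent using (×-poset)
open import Data.Vec.Base using (Vec; []; _∷_; lookup; toList)
import Data.Vec.Properties as Vec
open import Data.Vec.Relation.Binary.Pointwise.Inductive as Pointwise using (Pointwise; []; _∷_)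
import Data.Vec.Relation.Unary.All as All
import Data.Vec.Relation.Unary.AllPairs as AllPairs
open import Function.Bundles using (Inverse)
open import Level using (Level; 0ℓ; _⊔_; suc)
open import Relation.Binary.Bundles using (Poset; DecPoset)
import Relation.Binary.Construct.On as On
open import Relation.Binary.Definitions using (Reflexive; Transitive; Antisymmetric)
open import Relation.Binary.Morphism.Structures using (IsOrderIsomorphism)
open import Relation.Binary.PropositionalEquality as ≡ using (_≡_)
open import Relation.Nullary.Decidable using (Dec; does; map′; ¬?; _×-dec_; _→-dec_; from-yes)
open import Relation.Nullary.Negation using (¬_)
open import Relation.Unary using (Pred; Decidable; ∁)

-- The real numbers are not available in the library; the theory is
-- developed over an arbitrary field of characteristic zero, of which ℝ
-- (with x # y meaning x ≠ y) is an instance.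
record CharZeroField (a ℓ₁ ℓ₂ : Level) : Set (suc (a ⊔ ℓ₁ ⊔ ℓ₂)) where
  field
    heytingField : HeytingField a ℓ₁ ℓ₂

  open HeytingField heytingField public

  commutativeRing : CommutativeRing a ℓ₁
  commutativeRing = record { isCommutativeRing = isCommutativeRing }

  open RawMonoidDefs (CommutativeRing.+-rawMonoid commutativeRing) public
    using () renaming (_×_ to _·_; sum to ∑ᶠ)

  fromℕ : ℕ → Carrier
  fromℕ n = n · 1#

  field
    charZero : ∀ n → .{{_ : NonZero n}} → fromℕ n # 0#

  -- Literally, `#⇒invertible` provides an inverse of 2 - 0.
  infixl 7 _/2
  _/2 : Carrier → Carrier
  x /2 = x * proj₁ (#⇒invertible (charZero 2))

record FinitePoset : Set₁ where
  field
    decPoset : DecPoset 0ℓ 0ℓ 0ℓ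

  open DecPoset decPoset public

  field
    size        : ℕ
    enumeration : Inverse (≡.setoid (Fin size)) Eq.setoid

  element : Fin size → Carrier
  element = Inverse.to enumeration

  ∀? : {Q : Pred Carrier 0ℓ} → (∀ {x y} → x ≈ y → Q x → Q y) →
       Decidable Q → Dec (∀ x → Q x)
  ∀? resp Q? = map′
    (λ q x → resp (Inverse.strictlyInverseˡ enumeration x)
                  (q (Inverse.from enumeration x)))
    (λ q i → q (element i))
    (Fin.all? (λ i → Q? (element i)))

  Minimal Maximal : Pred Carrier 0ℓ → Pred Carrier 0ℓ
  Minimal Q x = Q x × (∀ y → Q y → y ≤ x → y ≈ x)
  Maximal Q x = Q x × (∀ y → Q y → x ≤ y → y ≈ x)

-- Decidability of membership is what classically comes for free; it makes
-- the {0,1}-valued statistics below definable.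
record OrderIdeal (P : FinitePoset) : Set₁ where
  open FinitePoset P
  field
    member     : Pred Carrier 0ℓ
    member?    : Decidable member
    downClosed : ∀ {x y} → y ≤ x → member x → member y

  member-resp : ∀ {x y} → x ≈ y → member x → member y
  member-resp x≈y = downClosed (reflexive (Eq.sym x≈y))

  minimalOutside? : Decidable (Minimal (∁ member))
  minimalOutside? x = ¬? (member? x) ×-dec
    ∀? (λ y≈z h z∉I z≤x →
          Eq.trans (Eq.sym y≈z)
            (h (λ y∈I → z∉I (member-resp y≈z y∈I))
               (trans (reflexive y≈z) z≤x)))
       (λ y → ¬? (member? y) →-dec (y ≤? x →-dec y ≟ x))

  maximalInside? : Decidable (Maximal member)
  maximalInside? x = member? x ×-dec
    ∀? (λ y≈z h z∈I x≤z →
          Eq.trans (Eq.sym y≈z)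
            (h (member-resp (Eq.sym y≈z) z∈I)
               (trans x≤z (reflexive (Eq.sym y≈z)))))
       (λ y → member? y →-dec (x ≤? y →-dec y ≟ x))

module Statistics {a ℓ₁ ℓ₂} (K : CharZeroField a ℓ₁ ℓ₂) (P : FinitePoset) where

  private
    module K = CharZeroField K
    module P = FinitePoset P

  Statistic : Set (suc 0ℓ ⊔ a)
  Statistic = OrderIdeal P → K.Carrier

  constant : K.Carrier → Statistic
  constant r _ = r

  ∑ : (P.Carrier → Statistic) → Statistic
  ∑ f I = K.∑ᶠ (λ i → f (P.element i) I)

  [_] : {Q : Set} → Dec Q → K.Carrier
  [ Q? ] = if does Q? then K.1# else K.0#

  𝟙 T⁺ T⁻ T : P.Carrier → Statistic
  𝟙  x I = [ OrderIdeal.member? I x ]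
  T⁺ x I = [ OrderIdeal.minimalOutside? I x ]
  T⁻ x I = [ OrderIdeal.maximalInside? I x ]
  T  x I = T⁺ x I K.- T⁻ x I

  infix 4 _≋_
  _≋_ : Statistic → Statistic → Set (suc 0ℓ ⊔ a ⊔ ℓ₁)
  f ≋ g = Σ[ c ∈ (P.Carrier → K.Carrier) ]
    (∀ I → (f I K.- g I) K.≈ ∑ (λ x J → c x K.* T x J) I)

rectangle : ℕ → ℕ → Poset 0ℓ 0ℓ 0ℓ
rectangle a b = ×-poset (Fin.≤-poset a) (Fin.≤-poset b)

shiftedStaircase : ℕ → Poset 0ℓ 0ℓ 0ℓ
shiftedStaircase n = On.poset (rectangle n n)
  (proj₁ {B = λ ij → proj₁ ij Fin.≤ proj₂ ij})

-- `x i` is x_{i+1}, and `z i` is z_{i+1}; the z's decrease with the index.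
data Diamond (n : ℕ) : Set where
  x     : Fin (n ℕ.∸ 1) → Diamond n
  y₁ y₂ : Diamond n
  z     : Fin (n ℕ.∸ 1) → Diamond n

infix 4 _⊑_
data _⊑_ {n : ℕ} : Diamond n → Diamond n → Set where
  x⊑x   : ∀ {i j} → i Fin.≤ j → x i ⊑ x j
  x⊑y₁  : ∀ {i} → x i ⊑ y₁
  x⊑y₂  : ∀ {i} → x i ⊑ y₂
  x⊑z   : ∀ {i k} → x i ⊑ z k
  y₁⊑y₁ : y₁ ⊑ y₁
  y₂⊑y₂ : y₂ ⊑ y₂
  y₁⊑z  : ∀ {k} → y₁ ⊑ z k
  y₂⊑z  : ∀ {k} → y₂ ⊑ z k
  z⊑z   : ∀ {k l} → l Fin.≤ k → z k ⊑ z l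

⊑-refl : ∀ {n} → Reflexive (_⊑_ {n})
⊑-refl {x = x i} = x⊑x Fin.≤-refl
⊑-refl {x = y₁}  = y₁⊑y₁
⊑-refl {x = y₂}  = y₂⊑y₂
⊑-refl {x = z k} = z⊑z Fin.≤-refl

⊑-trans : ∀ {n} → Transitive (_⊑_ {n})
⊑-trans (x⊑x p) (x⊑x q) = x⊑x (Fin.≤-trans p q)
⊑-trans (x⊑x _) x⊑y₁    = x⊑y₁
⊑-trans (x⊑x _) x⊑y₂    = x⊑y₂
⊑-trans (x⊑x _) x⊑z     = x⊑z
⊑-trans x⊑y₁    y₁⊑y₁   = x⊑y₁
⊑-trans x⊑y₁    y₁⊑z    = x⊑z
⊑-trans x⊑y₂    y₂⊑y₂   = x⊑y₂
⊑-trans x⊑y₂    y₂⊑z    = x⊑z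
⊑-trans x⊑z     (z⊑z _) = x⊑z
⊑-trans y₁⊑y₁   q       = q
⊑-trans y₂⊑y₂   q       = q
⊑-trans y₁⊑z    (z⊑z _) = y₁⊑z
⊑-trans y₂⊑z    (z⊑z _) = y₂⊑z
⊑-trans (z⊑z p) (z⊑z q) = z⊑z (Fin.≤-trans q p)

⊑-antisym : ∀ {n} → Antisymmetric _≡_ (_⊑_ {n})
⊑-antisym (x⊑x p) (x⊑x q) = ≡.cong x (Fin.≤-antisym p q)
⊑-antisym y₁⊑y₁   _       = ≡.refl
⊑-antisym y₂⊑y₂   _       = ≡.refl
⊑-antisym (z⊑z p) (z⊑z q) = ≡.cong z (Fin.≤-antisym q p)

doubleTailedDiamond : ℕ → Poset 0ℓ 0ℓ 0ℓ
doubleTailedDiamond n = record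
  { Carrier = Diamond n
  ; _≈_     = _≡_
  ; _≤_     = _⊑_
  ; isPartialOrder = record
    { isPreorder = record
      { isEquivalence = ≡.isEquivalence
      ; reflexive     = λ { ≡.refl → ⊑-refl }
      ; trans         = ⊑-trans
      }
    ; antisym = ⊑-antisym
    }
  }

vecPoset : ℕ → Poset 0ℓ 0ℓ 0ℓ
vecPoset n = record
  { Carrier = Vec ℕ n
  ; _≈_     = _≡_
  ; _≤_     = Pointwise ℕ._≤_
  ; isPartialOrder = record
    { isPreorder = record
      { isEquivalence = ≡.isEquivalence
      ; reflexive     = λ { ≡.refl → Pointwise.refl ℕ.≤-refl }
      ; trans         = Pointwise.trans ℕ.≤-trans
      }
    ; antisym = antisym
    }
  }
  where
  antisym : ∀ {m} → Antisymmetric _≡_ (Pointwise ℕ._≤_ {m} {m})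
  antisym []       []       = ≡.refl
  antisym (p ∷ ps) (q ∷ qs) = ≡.cong₂ _∷_ (ℕ.≤-antisym p q) (antisym ps qs)

-- The minuscule poset of a minuscule node i of a simply laced diagram is
-- the set of positive roots in which the simple root αᵢ has coefficient 1,
-- ordered by β ≤ γ iff γ - β is a nonnegative combination of simple roots.
-- The tables list the coefficient vectors of these roots in the basis of
-- simple roots, numbered as in Bourbaki: the branch node is 4, adjacent to
-- 2, 3 and 5, and the long path is 1-3-4-5-6(-7).  The minuscule node is 1
-- for E₆ and 7 for E₇; the other minuscule node of E₆, 6, gives an
-- isomorphic poset.

E₆-roots : Vec (Vec ℕ 6) 16
E₆-roots =
  (1 ∷ 0 ∷ 0 ∷ 0 ∷ 0 ∷ 0 ∷ []) ∷
  (1 ∷ 0 ∷ 1 ∷ 0 ∷ 0 ∷ 0 ∷ []) ∷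
  (1 ∷ 0 ∷ 1 ∷ 1 ∷ 0 ∷ 0 ∷ []) ∷
  (1 ∷ 1 ∷ 1 ∷ 1 ∷ 0 ∷ 0 ∷ []) ∷
  (1 ∷ 0 ∷ 1 ∷ 1 ∷ 1 ∷ 0 ∷ []) ∷
  (1 ∷ 1 ∷ 1 ∷ 1 ∷ 1 ∷ 0 ∷ []) ∷
  (1 ∷ 0 ∷ 1 ∷ 1 ∷ 1 ∷ 1 ∷ []) ∷
  (1 ∷ 1 ∷ 1 ∷ 2 ∷ 1 ∷ 0 ∷ []) ∷
  (1 ∷ 1 ∷ 1 ∷ 1 ∷ 1 ∷ 1 ∷ []) ∷
  (1 ∷ 1 ∷ 2 ∷ 2 ∷ 1 ∷ 0 ∷ []) ∷
  (1 ∷ 1 ∷ 1 ∷ 2 ∷ 1 ∷ 1 ∷ []) ∷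
  (1 ∷ 1 ∷ 2 ∷ 2 ∷ 1 ∷ 1 ∷ []) ∷
  (1 ∷ 1 ∷ 1 ∷ 2 ∷ 2 ∷ 1 ∷ []) ∷
  (1 ∷ 1 ∷ 2 ∷ 2 ∷ 2 ∷ 1 ∷ []) ∷
  (1 ∷ 1 ∷ 2 ∷ 3 ∷ 2 ∷ 1 ∷ []) ∷
  (1 ∷ 2 ∷ 2 ∷ 3 ∷ 2 ∷ 1 ∷ []) ∷
  []

E₇-roots : Vec (Vec ℕ 7) 27
E₇-roots =
  (0 ∷ 0 ∷ 0 ∷ 0 ∷ 0 ∷ 0 ∷ 1 ∷ []) ∷
  (0 ∷ 0 ∷ 0 ∷ 0 ∷ 0 ∷ 1 ∷ 1 ∷ []) ∷
  (0 ∷ 0 ∷ 0 ∷ 0 ∷ 1 ∷ 1 ∷ 1 ∷ []) ∷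
  (0 ∷ 0 ∷ 0 ∷ 1 ∷ 1 ∷ 1 ∷ 1 ∷ []) ∷
  (0 ∷ 1 ∷ 0 ∷ 1 ∷ 1 ∷ 1 ∷ 1 ∷ []) ∷
  (0 ∷ 0 ∷ 1 ∷ 1 ∷ 1 ∷ 1 ∷ 1 ∷ []) ∷
  (1 ∷ 0 ∷ 1 ∷ 1 ∷ 1 ∷ 1 ∷ 1 ∷ []) ∷
  (0 ∷ 1 ∷ 1 ∷ 1 ∷ 1 ∷ 1 ∷ 1 ∷ []) ∷
  (1 ∷ 1 ∷ 1 ∷ 1 ∷ 1 ∷ 1 ∷ 1 ∷ []) ∷
  (0 ∷ 1 ∷ 1 ∷ 2 ∷ 1 ∷ 1 ∷ 1 ∷ []) ∷
  (1 ∷ 1 ∷ 1 ∷ 2 ∷ 1 ∷ 1 ∷ 1 ∷ []) ∷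
  (0 ∷ 1 ∷ 1 ∷ 2 ∷ 2 ∷ 1 ∷ 1 ∷ []) ∷
  (1 ∷ 1 ∷ 2 ∷ 2 ∷ 1 ∷ 1 ∷ 1 ∷ []) ∷
  (1 ∷ 1 ∷ 1 ∷ 2 ∷ 2 ∷ 1 ∷ 1 ∷ []) ∷
  (0 ∷ 1 ∷ 1 ∷ 2 ∷ 2 ∷ 2 ∷ 1 ∷ []) ∷
  (1 ∷ 1 ∷ 2 ∷ 2 ∷ 2 ∷ 1 ∷ 1 ∷ []) ∷
  (1 ∷ 1 ∷ 1 ∷ 2 ∷ 2 ∷ 2 ∷ 1 ∷ []) ∷
  (1 ∷ 1 ∷ 2 ∷ 3 ∷ 2 ∷ 1 ∷ 1 ∷ []) ∷
  (1 ∷ 1 ∷ 2 ∷ 2 ∷ 2 ∷ 2 ∷ 1 ∷ []) ∷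
  (1 ∷ 2 ∷ 2 ∷ 3 ∷ 2 ∷ 1 ∷ 1 ∷ []) ∷
  (1 ∷ 1 ∷ 2 ∷ 3 ∷ 2 ∷ 2 ∷ 1 ∷ []) ∷
  (1 ∷ 2 ∷ 2 ∷ 3 ∷ 2 ∷ 2 ∷ 1 ∷ []) ∷
  (1 ∷ 1 ∷ 2 ∷ 3 ∷ 3 ∷ 2 ∷ 1 ∷ []) ∷
  (1 ∷ 2 ∷ 2 ∷ 3 ∷ 3 ∷ 2 ∷ 1 ∷ []) ∷
  (1 ∷ 2 ∷ 2 ∷ 4 ∷ 3 ∷ 2 ∷ 1 ∷ []) ∷
  (1 ∷ 2 ∷ 3 ∷ 4 ∷ 3 ∷ 2 ∷ 1 ∷ []) ∷
  (2 ∷ 2 ∷ 3 ∷ 4 ∷ 3 ∷ 2 ∷ 1 ∷ []) ∷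
  []

ΛE₆ ΛE₇ : Poset 0ℓ 0ℓ 0ℓ
ΛE₆ = On.poset (vecPoset 6) (lookup E₆-roots)
ΛE₇ = On.poset (vecPoset 7) (lookup E₇-roots)

-- Sanity check of the tables: in a simply laced root system of finite type
-- an element β of the root lattice is a root iff ∑ᵢ βᵢ² - ∑ βᵢ βⱼ = 1,
-- the second sum being over the edges ij of the diagram.

IsRoot : ∀ {n} → List (Fin n × Fin n) → Vec ℕ n → Set
IsRoot edges β =
  sum (map (λ b → b ℕ.* b) (toList β)) ≡
  1 ℕ.+ sum (map (λ (i , j) → lookup β i ℕ.* lookup β j) edges)

IsMinusculeRoot : ∀ {n} → List (Fin n × Fin n) → Fin n → Vec ℕ n → Set
IsMinusculeRoot edges i β = IsRoot edges β × lookup β i ≡ 1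

isMinusculeRoot? : ∀ {n} (edges : List (Fin n × Fin n)) i →
                   Decidable (IsMinusculeRoot edges i)
isMinusculeRoot? edges i β = (_ ℕ.≟ _) ×-dec (_ ℕ.≟ _)

E₆-edges : List (Fin 6 × Fin 6)
E₆-edges = (# 0 , # 2) ∷ (# 2 , # 3) ∷ (# 1 , # 3) ∷ (# 3 , # 4) ∷ (# 4 , # 5) ∷ []

E₇-edges : List (Fin 7 × Fin 7)
E₇-edges = (# 0 , # 2) ∷ (# 2 , # 3) ∷ (# 1 , # 3) ∷ (# 3 , # 4) ∷ (# 4 , # 5) ∷
           (# 5 , # 6) ∷ []

E₆-check : All.All (IsMinusculeRoot E₆-edges (# 0)) E₆-roots
E₆-check = from-yes (All.all? (isMinusculeRoot? E₆-edges (# 0)) E₆-roots)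

E₇-check : All.All (IsMinusculeRoot E₇-edges (# 6)) E₇-roots
E₇-check = from-yes (All.all? (isMinusculeRoot? E₇-edges (# 6)) E₇-roots)

E₆-distinct : AllPairs.AllPairs (λ β γ → ¬ β ≡ γ) E₆-roots
E₆-distinct = from-yes (AllPairs.allPairs? (λ β γ → ¬? (Vec.≡-dec ℕ._≟_ β γ)) E₆-roots)

E₇-distinct : AllPairs.AllPairs (λ β γ → ¬ β ≡ γ) E₇-roots
E₇-distinct = from-yes (AllPairs.allPairs? (λ β γ → ¬? (Vec.≡-dec ℕ._≟_ β γ)) E₇-roots)

infix 4 _≅_
_≅_ : FinitePoset → Poset 0ℓ 0ℓ 0ℓ → Set
P ≅ Q = ∃[ f ] IsOrderIsomorphism P._≈_ Q._≈_ P._≤_ Q._≤_ f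
  where
  module P = FinitePoset P
  module Q = Poset Q

data IsMinuscule (P : FinitePoset) : Set where
  isRectangle           : ∀ a b → .{{_ : NonZero a}} → .{{_ : NonZero b}} →
                          P ≅ rectangle a b → IsMinuscule P
  isShiftedStaircase    : ∀ n → .{{_ : NonZero n}} →
                          P ≅ shiftedStaircase n → IsMinuscule P
  isDoubleTailedDiamond : ∀ n → 2 ℕ.≤ n →
                          P ≅ doubleTailedDiamond n → IsMinuscule P
  isΛE₆                 : P ≅ ΛE₆ → IsMinuscule P
  isΛE₇                 : P ≅ ΛE₇ → IsMinuscule P

{-# OPTIONS --safe #-}

-- A minuscule poset can be drawn in the plane so that its order is the
-- componentwise one and every cover is a unit step.  For an order ideal with
-- indicator e, writing m(x) for the minimum of e over the lower covers of x
-- and M(x) for its maximum over the upper covers,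
--   T⁺ₓ + eₓ = m(x)   and   T⁻ₓ + M(x) = eₓ.
-- If p and q are opposite corners of a unit square of the drawing whose other
-- corners are u and v, then M(p) + m(q) = max(e_u, e_v) + min(e_u, e_v) =
-- e_u + e_v.  So a combination ∑ wₓ Tₓ whose weights agree at p and q for all
-- such squares is linear in e; taking for w the coefficients of 2ρ^∨ in the
-- simple coroots, it becomes w(bottom) - 2 ∑ eₓ.  The whole poset, where only
-- T⁻ at the top survives, shows that w(bottom) = #P, and -w/2 are the
-- required constants.

module Submission where

open import Defs hiding (x; y₁; y₂; z)

open import Algebra.Bundles using (CommutativeRing)
import Algebra.Properties.Ring as RingProperties
import Algebra.Properties.Semiring.Mult as SemiringMult
import Algebra.Properties.Semiring.Sum as SemiringSum
open import Data.Bool.Base using (if_then_else_)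
open import Data.Bool.Properties using (∧-comm)
open import Data.Fin.Base as Fin using (Fin; toℕ; fromℕ<; punchIn)
import Data.Fin.Properties as Fin
open import Data.Nat.Base as ℕ
  using (ℕ; zero; suc; NonZero; _+_; _*_; _∸_; _≤_; _<_; z≤n; s≤s)
import Data.Nat.Properties as ℕ
open import Data.Nat.Tactic.RingSolver using (solve-∀)
open import Data.Product.Base using (∃-syntax; _×_; _,_; proj₁; proj₂)
open import Data.Sum.Base using (_⊎_; inj₁; inj₂; [_,_]′)
open import Data.Unit.Base using (⊤; tt)
open import Data.Vec.Base using (Vec; []; _∷_; lookup)
open import Data.Vec.Relation.Binary.Pointwise.Inductive using (Pointwise; decidable)
open import Function.Base using (_∘_; _$_)
open import Function.Bundles using (Inverse)
open import Level using (0ℓ)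
open import Relation.Binary.Bundles using (Poset)
import Relation.Binary.Construct.On as On
open import Relation.Binary.Morphism.Structures using (IsOrderIsomorphism)
open import Relation.Binary.PropositionalEquality as ≡
  using (_≡_; _≢_; refl; sym; trans; cong; cong₂; subst; module ≡-Reasoning)
import Relation.Binary.Reasoning.Setoid as SetoidReasoning
open import Relation.Nullary.Decidable
  using (Dec; yes; no; does; True; toWitness; _×-dec_; _⊎-dec_; _→-dec_;
         dec-true; dec-false; decidable-stable)
open import Relation.Nullary.Negation using (¬_; contradiction)

open SemiringSum ℕ.+-*-semiring
  using (sum; sum-syntax; sum-cong-≗; sum-remove; sum-replicate-zero; ∑-distrib-+; ∑-comm; *-distribˡ-sum)

-- The squares with missing corners need separate care. If exactly one of u and v is in the poset,
-- minimum and maximum both equal its indicator, which then receives w(p) + w(q), and no equality of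
-- weights is required. If both are missing and q is present, the empty minimum is 1 and the empty
-- maximum 0; this happens only when q is the bottom, and it produces the constant w(bottom).
-- Extending the weights by 0 turns all cases into one sum over the squares of a grid. As for 2ρ^∨:
-- p and q carry the same simple root when u and v are both present, so the multiplicities that x
-- collects from its two squares add up to the sum of the weights over the neighbours of its label
-- in the Dynkin diagram. Subtracting 2wₓ leaves -⟨2ρ^∨, α⟩ = -2 for the simple root α labelling x.
-- The identity is proved in ℕ without subtraction; the field enters only for the signs and the
-- halving.

sum-zero : ∀ {n} (f : Fin n → ℕ) → (∀ k → f k ≡ 0) → sum f ≡ 0
sum-zero {n} f f≡0 = trans (sum-cong-≗ f≡0) (sum-replicate-zero n)

sum-single : ∀ {n} (k : Fin n) (f : Fin n → ℕ) → (∀ i → i ≢ k → f i ≡ 0) → sum f ≡ f k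
sum-single {suc n} k f f≡0 = begin
  sum f                       ≡⟨ sum-remove {i = k} f ⟩
  f k + sum (f ∘ punchIn k)   ≡⟨ cong (f k +_) (sum-zero _ λ i → f≡0 _ (Fin.punchInᵢ≢i k i)) ⟩
  f k + 0                     ≡⟨ ℕ.+-identityʳ (f k) ⟩
  f k                         ∎
  where open ≡-Reasoning

sum-const-1 : ∀ n → ∑[ k < n ] 1 ≡ n
sum-const-1 zero    = refl
sum-const-1 (suc n) = cong suc (sum-const-1 n)

-- Both sides are the sum over `0, ..., n` with one end term left out, and both end terms vanish.
sum-shift : ∀ n (f : ℕ → ℕ) → f 0 ≡ 0 → f n ≡ 0 →
            ∑[ i < n ] f (suc (toℕ i)) ≡ ∑[ i < n ] f (toℕ i)
sum-shift n f f₀ fₙ = begin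
  ∑[ i < n ] f (suc (toℕ i))         ≡⟨ cong (_+ ∑[ i < n ] f (suc (toℕ i))) f₀ ⟨
  f 0 + ∑[ i < n ] f (suc (toℕ i))   ≡⟨ last-term n f ⟩
  ∑[ i < n ] f (toℕ i) + f n         ≡⟨ cong (∑[ i < n ] f (toℕ i) +_) fₙ ⟩
  ∑[ i < n ] f (toℕ i) + 0           ≡⟨ ℕ.+-identityʳ _ ⟩
  ∑[ i < n ] f (toℕ i)               ∎
  where
  open ≡-Reasoning
  last-term : ∀ n (f : ℕ → ℕ) →
              f 0 + ∑[ i < n ] f (suc (toℕ i)) ≡ ∑[ i < n ] f (toℕ i) + f n
  last-term zero    f = ℕ.+-identityʳ (f 0)
  last-term (suc n) f = trans (cong (f 0 +_) (last-term n (f ∘ suc))) (sym (ℕ.+-assoc (f 0) _ _))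

-- Double sums over a grid, and sums over a finite family of grid points

gridSum : ℕ → ℕ → (ℕ → ℕ → ℕ) → ℕ
gridSum m n f = ∑[ i < m ] ∑[ j < n ] f (toℕ i) (toℕ j)

gridSum-cong : ∀ m n {f g : ℕ → ℕ → ℕ} → (∀ i j → f i j ≡ g i j) → gridSum m n f ≡ gridSum m n g
gridSum-cong m n f≡g = sum-cong-≗ {m} λ i → sum-cong-≗ {n} λ j → f≡g (toℕ i) (toℕ j)

gridSum-+ : ∀ m n (f g : ℕ → ℕ → ℕ) →
            gridSum m n (λ i j → f i j + g i j) ≡ gridSum m n f + gridSum m n g
gridSum-+ m n f g = trans
  (sum-cong-≗ {m} λ i → ∑-distrib-+ {n} (λ j → f (toℕ i) (toℕ j)) (λ j → g (toℕ i) (toℕ j)))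
  (∑-distrib-+ {m} (λ i → ∑[ j < n ] f (toℕ i) (toℕ j)) (λ i → ∑[ j < n ] g (toℕ i) (toℕ j)))

gridSum-shiftRow : ∀ m n (f : ℕ → ℕ → ℕ) → (∀ j → f 0 j ≡ 0) → (∀ j → f m j ≡ 0) →
                   gridSum m n (λ i j → f (suc i) j) ≡ gridSum m n f
gridSum-shiftRow m n f f₀ fₘ = sum-shift m (λ i → ∑[ j < n ] f i (toℕ j))
  (sum-zero {n} _ (f₀ ∘ toℕ)) (sum-zero {n} _ (fₘ ∘ toℕ))

gridSum-shiftCol : ∀ m n (f : ℕ → ℕ → ℕ) → (∀ i → f i 0 ≡ 0) → (∀ i → f i n ≡ 0) →
                   gridSum m n (λ i j → f i (suc j)) ≡ gridSum m n f
gridSum-shiftCol m n f f₀ fₙ =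
  sum-cong-≗ {m} λ i → sum-shift n (f (toℕ i)) (f₀ (toℕ i)) (fₙ (toℕ i))

gridSum-single : ∀ m n (f : ℕ → ℕ → ℕ) {i₀ j₀} → i₀ < m → j₀ < n →
                 (∀ i j → ¬ (i₀ ≡ i × j₀ ≡ j) → f i j ≡ 0) → gridSum m n f ≡ f i₀ j₀
gridSum-single m n f {i₀} {j₀} i₀<m j₀<n f≡0 = begin
  gridSum m n f                     ≡⟨ sum-single (fromℕ< i₀<m) _ (λ i i≢ →
                                         sum-zero {n} _ λ j → f≡0 _ (toℕ j) λ (p , _) → i≢ (unique i₀<m p)) ⟩
  ∑[ j < n ] f i′ (toℕ j)           ≡⟨ sum-single (fromℕ< j₀<n) _ (λ j j≢ →
                                         f≡0 _ _ λ (_ , q) → j≢ (unique j₀<n q)) ⟩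
  f i′ j′                           ≡⟨ cong₂ f (Fin.toℕ-fromℕ< i₀<m) (Fin.toℕ-fromℕ< j₀<n) ⟩
  f i₀ j₀                           ∎
  where
  open ≡-Reasoning
  i′ = toℕ (fromℕ< i₀<m)
  j′ = toℕ (fromℕ< j₀<n)
  unique : ∀ {l k} (k<l : k < l) {i : Fin l} → k ≡ toℕ i → i ≡ fromℕ< k<l
  unique k<l k≡i = Fin.toℕ-injective (trans (sym k≡i) (sym (Fin.toℕ-fromℕ< k<l)))

-- Each term is spread over the grid as a function supported at `(r k , c k)`. After the sums are
-- exchanged, injectivity leaves at most one `k` per grid point, and `support` supplies one wherever
-- `f` is nonzero.
sum≡gridSum : ∀ {N} m n (r c : Fin N → ℕ) (f : ℕ → ℕ → ℕ) →
              (∀ k → r k < m) → (∀ k → c k < n) →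
              (∀ {k l} → r k ≡ r l → c k ≡ c l → k ≡ l) →
              (∀ i j → NonZero (f i j) → ∃[ k ] (r k ≡ i × c k ≡ j)) →
              ∑[ k < N ] f (r k) (c k) ≡ gridSum m n f
sum≡gridSum {N} m n r c f r<m c<n injective support = begin
  ∑[ k < N ] f (r k) (c k)
    ≡⟨ sum-cong-≗ {N} (λ k → trans (sym (g-at k)) (sym (gridSum-single m n (g k) (r<m k) (c<n k) g-off))) ⟩
  ∑[ k < N ] ∑[ i < m ] ∑[ j < n ] g k (toℕ i) (toℕ j)
    ≡⟨ ∑-comm {N} {m} (λ k i → ∑[ j < n ] g k (toℕ i) (toℕ j)) ⟩
  ∑[ i < m ] ∑[ k < N ] ∑[ j < n ] g k (toℕ i) (toℕ j)
    ≡⟨ sum-cong-≗ {m} (λ i → ∑-comm {N} {n} (λ k j → g k (toℕ i) (toℕ j))) ⟩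
  ∑[ i < m ] ∑[ j < n ] ∑[ k < N ] g k (toℕ i) (toℕ j)
    ≡⟨ gridSum-cong m n collect ⟩
  gridSum m n f ∎
  where
  open ≡-Reasoning
  at? : ∀ k i j → Dec (r k ≡ i × c k ≡ j)
  at? k i j = (r k ℕ.≟ i) ×-dec (c k ℕ.≟ j)

  g : Fin N → ℕ → ℕ → ℕ
  g k i j with at? k i j
  ... | yes _ = f i j
  ... | no  _ = 0

  g-on : ∀ {k i j} → r k ≡ i × c k ≡ j → g k i j ≡ f i j
  g-on {k} {i} {j} p with at? k i j
  ... | yes _ = refl
  ... | no ¬p = contradiction p ¬p

  g-off : ∀ {k} i j → ¬ (r k ≡ i × c k ≡ j) → g k i j ≡ 0
  g-off {k} i j ¬p with at? k i j
  ... | yes p = contradiction p ¬p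
  ... | no _  = refl

  g-at : ∀ k → g k (r k) (c k) ≡ f (r k) (c k)
  g-at k = g-on (refl , refl)

  g-zero : ∀ {k i j} → f i j ≡ 0 → g k i j ≡ 0
  g-zero {k} {i} {j} f≡0 with at? k i j
  ... | yes _ = f≡0
  ... | no _  = refl

  collect : ∀ i j → ∑[ k < N ] g k i j ≡ f i j
  collect i j with f i j ℕ.≟ 0
  ... | yes f≡0 = trans (sum-zero {N} _ (λ k → g-zero f≡0)) (sym f≡0)
  ... | no f≢0 with support i j (ℕ.≢-nonZero f≢0)
  ...   | k , rk , ck = trans
    (sum-single k (λ l → g l i j) λ l l≢k → g-off i j λ (rl , cl) →
      l≢k (injective (trans rl (sym rk)) (trans cl (sym ck))))
    (g-on (rk , ck))

-- Indicators, and the identity for one unit square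

if-yes : ∀ {a} {A : Set a} (A? : Dec A) {k l : ℕ} → A → (if does A? then k else l) ≡ k
if-yes A? {k} {l} p = cong (λ b → if b then k else l) (dec-true A? p)

if-no : ∀ {a} {A : Set a} (A? : Dec A) {k l : ℕ} → ¬ A → (if does A? then k else l) ≡ l
if-no A? {k} {l} ¬p = cong (λ b → if b then k else l) (dec-false A? ¬p)

𝟏 : ∀ {a} {A : Set a} → Dec A → ℕ
𝟏 A? = if does A? then 1 else 0

𝟏-true : ∀ {a} {A : Set a} (A? : Dec A) → A → 𝟏 A? ≡ 1
𝟏-true A? = if-yes A?

𝟏-false : ∀ {a} {A : Set a} (A? : Dec A) → ¬ A → 𝟏 A? ≡ 0
𝟏-false A? = if-no A?

𝟏-⇔ : ∀ {a b} {A : Set a} {B : Set b} (A? : Dec A) (B? : Dec B) →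
      (A → B) → (B → A) → 𝟏 A? ≡ 𝟏 B?
𝟏-⇔ (yes x) B? f g = sym (𝟏-true B? (f x))
𝟏-⇔ (no ¬x) B? f g = sym (𝟏-false B? (¬x ∘ g))

-- The hypotheses make `C` the disjoint union of `A` and `B`. The last one may assume `¬ B`, which
-- is the form in which minimality and maximality are derived below.
𝟏-⊎ : ∀ {a b c} {A : Set a} {B : Set b} {C : Set c} (A? : Dec A) (B? : Dec B) (C? : Dec C) →
      (A → ¬ B) → (A → C) → (B → C) → (C → ¬ B → A) → 𝟏 A? + 𝟏 B? ≡ 𝟏 C?
𝟏-⊎ (yes x) B?      C? disj f g h = trans (cong suc (𝟏-false B? (disj x))) (sym (𝟏-true C? (f x)))
𝟏-⊎ (no _)  (yes y) C? disj f g h = sym (𝟏-true C? (g y))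
𝟏-⊎ (no ¬x) (no ¬y) C? disj f g h = sym (𝟏-false C? λ z → ¬x (h z ¬y))

-- Let p = (i,j) and q = (i+1,j+1), and let o and o′ be the other two corners
-- of their unit square.  `coefficient o p q` is the multiplicity of the
-- indicator of o′ in mesh-identity; all four are weights, with 0 for a point
-- that is not in the poset.
coefficient : ℕ → ℕ → ℕ → ℕ
coefficient zero    p q = p + q
coefficient (suc _) p q = q

-- The constant left by a square whose corners `u` and `v` are both missing: the condition on lower
-- covers is vacuous, so `q` is contributed whatever the ideal.
source : ℕ → ℕ → ℕ → ℕ
source zero    zero    q = q
source zero    (suc _) _ = 0
source (suc _) _       _ = 0

-- When u and v are both present this is min + max = sum for the indicators
-- of U and V.
mesh-identity : ∀ {U V : Set} u v p q (U? : Dec U) (V? : Dec V) →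
  (U → NonZero u) → (V → NonZero v) → (NonZero u → NonZero v → p ≡ q) →
  q * 𝟏 ((ℕ.nonZero? u →-dec U?) ×-dec (ℕ.nonZero? v →-dec V?)) + p * 𝟏 (U? ⊎-dec V?)
  ≡ source u v q + (coefficient v p q * 𝟏 U? + coefficient u p q * 𝟏 V?)
mesh-identity zero    _       _ _ (yes U) _       U⇒ _ _ with () ← ℕ.≢-nonZero⁻¹ 0 {{U⇒ U}} refl
mesh-identity _       zero    _ _ _       (yes V) _ V⇒ _ with () ← ℕ.≢-nonZero⁻¹ 0 {{V⇒ V}} refl
mesh-identity zero    zero    p q (no _)  (no _)  _ _ _ = identity p q
  where
  identity : ∀ p q → q * 1 + p * 0 ≡ q + ((p + q) * 0 + (p + q) * 0)
  identity = solve-∀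
-- With `u` missing, both indicators on the left reduce to that of `V`, so `p` and `q` need not
-- agree.
mesh-identity zero    (suc _) p q (no _)  (yes _) _ _ _ = identity p q
  where
  identity : ∀ p q → q * 1 + p * 1 ≡ q * 0 + (p + q) * 1
  identity = solve-∀
mesh-identity zero    (suc _) p q (no _)  (no _)  _ _ _ = identity p q
  where
  identity : ∀ p q → q * 0 + p * 0 ≡ q * 0 + (p + q) * 0
  identity = solve-∀
mesh-identity (suc _) zero    p q (yes _) (no _)  _ _ _ = identity p q
  where
  identity : ∀ p q → q * 1 + p * 1 ≡ (p + q) * 1 + q * 0
  identity = solve-∀
mesh-identity (suc _) zero    p q (no _)  (no _)  _ _ _ = identity p q
  where
  identity : ∀ p q → q * 0 + p * 0 ≡ (p + q) * 0 + q * 0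
  identity = solve-∀
mesh-identity (suc _) (suc _) p q (yes _) (yes _) _ _ p≡q = cong (λ r → q * 1 + r * 1) (p≡q _ _)
mesh-identity (suc _) (suc _) p q (yes _) (no _)  _ _ p≡q =
  trans (ℕ.+-comm (q * 0) (p * 1)) (cong (λ r → r * 1 + q * 0) (p≡q _ _))
mesh-identity (suc _) (suc _) p q (no _)  (yes _) _ _ p≡q = cong (λ r → q * 0 + r * 1) (p≡q _ _)
mesh-identity (suc _) (suc _) p q (no _)  (no _)  _ _ p≡q = cong (λ r → q * 0 + r * 0) (p≡q _ _)

-- Planar drawings of posets

-- A drawing of a poset in the plane: the order is the componentwise one and
-- every cover is a unit step.  The weights are indexed from 1, so that x has
-- the weight `weight (suc (row x)) (suc (col x))` and the border is 0; they
-- are the coefficients of 2ρ^∨ in the simple coroots labelling the elements.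
record Drawing (Q : Poset 0ℓ 0ℓ 0ℓ) : Set where
  private module Q = Poset Q
  field
    row col : Q.Carrier → ℕ
    ≤⇒grid  : ∀ {x y} → x Q.≤ y → row x ≤ row y × col x ≤ col y
    grid⇒≤  : ∀ {x y} → row x ≤ row y → col x ≤ col y → x Q.≤ y

    weight         : ℕ → ℕ → ℕ
    weight-nonZero : ∀ x → NonZero (weight (suc (row x)) (suc (col x)))
    weight-support : ∀ i j → NonZero (weight i j) → ∃[ x ] (suc (row x) ≡ i × suc (col x) ≡ j)

    -- The form in which covers are unit steps: unless `x` and `y` share a position, some neighbour
    -- of `y` one row or one column back is present and still above `x`. Nonzero weight encodes
    -- presence.
    lower : ∀ x y → row x ≤ row y → col x ≤ col y →
            (row x ≡ row y × col x ≡ col y) ⊎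
            (row x < row y × NonZero (weight (row y) (suc (col y)))) ⊎
            (col x < col y × NonZero (weight (suc (row y)) (col y)))

    mesh : ∀ x → NonZero (weight (2 + row x) (col x)) →
           weight (1 + row x) (col x) ≡ weight (2 + row x) (1 + col x)

    -- The relation ⟨2ρ^∨, α⟩ = 2. The two neighbours of `x` in one square have the same label if
    -- the fourth corner is present, and `coefficient` counts them once; otherwise both weights
    -- count, a missing neighbour giving 0.
    balance : ∀ x → let i = row x; j = col x in
      (coefficient (weight (2 + i) j) (weight (1 + i) j) (weight (2 + i) (1 + j)) +
       coefficient (weight i (2 + j)) (weight i (1 + j)) (weight (1 + i) (2 + j))) + 2
      ≡ 2 * weight (1 + i) (1 + j)

    bottom top : Q.Carrier
    least      : ∀ x → bottom Q.≤ x
    greatest   : ∀ x → x Q.≤ top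
    -- Bottom and top are labelled by the minuscule node and its image under -w₀, which have equal
    -- coefficients in 2ρ^∨.
    symmetric  : weight (suc (row top)) (suc (col top)) ≡
                 weight (suc (row bottom)) (suc (col bottom))

  weightOf : Q.Carrier → ℕ
  weightOf x = weight (suc (row x)) (suc (col x))

  row-cong : ∀ {x y} → x Q.≈ y → row x ≡ row y
  row-cong x≈y = ℕ.≤-antisym (proj₁ (≤⇒grid (Q.reflexive x≈y)))
                             (proj₁ (≤⇒grid (Q.reflexive (Q.Eq.sym x≈y))))

  col-cong : ∀ {x y} → x Q.≈ y → col x ≡ col y
  col-cong x≈y = ℕ.≤-antisym (proj₂ (≤⇒grid (Q.reflexive x≈y)))
                             (proj₂ (≤⇒grid (Q.reflexive (Q.Eq.sym x≈y))))

  weightOf-cong : ∀ {x y} → x Q.≈ y → weightOf x ≡ weightOf y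
  weightOf-cong x≈y = cong₂ (λ i j → weight (suc i) (suc j)) (row-cong x≈y) (col-cong x≈y)

  grid-injective : ∀ {x y} → row x ≡ row y → col x ≡ col y → x Q.≈ y
  grid-injective p q = Q.antisym (grid⇒≤ (ℕ.≤-reflexive p) (ℕ.≤-reflexive q))
                                 (grid⇒≤ (ℕ.≤-reflexive (sym p)) (ℕ.≤-reflexive (sym q)))

  infix 4 _⋖_
  _⋖_ : Q.Carrier → Q.Carrier → Set
  x ⋖ y = (suc (row x) ≡ row y × col x ≡ col y) ⊎ (row x ≡ row y × suc (col x) ≡ col y)

  ⋖⇒≤ : ∀ {x y} → x ⋖ y → x Q.≤ y
  ⋖⇒≤ (inj₁ (p , q)) = grid⇒≤ (ℕ.<⇒≤ (ℕ.≤-reflexive p)) (ℕ.≤-reflexive q)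
  ⋖⇒≤ (inj₂ (p , q)) = grid⇒≤ (ℕ.≤-reflexive p) (ℕ.<⇒≤ (ℕ.≤-reflexive q))

  ⋖⇒≉ : ∀ {x y} → x ⋖ y → ¬ x Q.≈ y
  ⋖⇒≉ (inj₁ (p , _)) x≈y = ℕ.1+n≢n (trans p (sym (row-cong x≈y)))
  ⋖⇒≉ (inj₂ (_ , q)) x≈y = ℕ.1+n≢n (trans q (sym (col-cong x≈y)))

  lowerCover : ∀ {x y} → x Q.≤ y → x Q.≈ y ⊎ (∃[ z ] (x Q.≤ z × z ⋖ y))
  lowerCover {x} {y} x≤y with ≤⇒grid x≤y
  ... | p , q with lower x y p q
  ...   | inj₁ (r , c) = inj₁ (grid-injective r c)
  ...   | inj₂ (inj₁ (r , nz)) =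
    let z , rz , cz = weight-support _ _ nz
    in inj₂ (z , grid⇒≤ (ℕ.≤-pred (subst (row x <_) (sym rz) r))
                        (subst (col x ≤_) (sym (ℕ.suc-injective cz)) q)
               , inj₁ (rz , ℕ.suc-injective cz))
  ...   | inj₂ (inj₂ (c , nz)) =
    let z , rz , cz = weight-support _ _ nz
    in inj₂ (z , grid⇒≤ (subst (row x ≤_) (sym (ℕ.suc-injective rz)) p)
                        (ℕ.≤-pred (subst (col x <_) (sym cz) c))
               , inj₂ (ℕ.suc-injective rz , cz))

  rank : Q.Carrier → ℕ
  rank x = row x + col x

  rank-⋖ : ∀ {x y} → x ⋖ y → rank x < rank y
  rank-⋖         (inj₁ (p , q)) = ℕ.≤-reflexive (cong₂ _+_ p q)
  rank-⋖ {x} {y} (inj₂ (p , q)) =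
    ℕ.≤-reflexive (trans (sym (ℕ.+-suc (row x) (col x))) (cong₂ _+_ p q))

  -- The field `lower` describes steps down only. Descending from `y` by lower covers until `x` is
  -- reached, the last step taken exhibits an upper cover of `x`; the fuel `n` bounds the rank,
  -- which drops at each step.
  upperCover : ∀ {x y} → x Q.≤ y → x Q.≈ y ⊎ (∃[ z ] (x ⋖ z × z Q.≤ y))
  upperCover {x} {y} x≤y = descend (suc (rank y)) x≤y ℕ.≤-refl
    where
    descend : ∀ n {y} → x Q.≤ y → rank y < n → x Q.≈ y ⊎ (∃[ z ] (x ⋖ z × z Q.≤ y))
    descend (suc n) {y} x≤y (s≤s y≤n) with lowerCover x≤y
    ... | inj₁ x≈y = inj₁ x≈y
    ... | inj₂ (w , x≤w , w⋖y) with descend n x≤w (ℕ.<-≤-trans (rank-⋖ w⋖y) y≤n)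
    ...   | inj₁ x≈w = inj₂ (y , x⋖y , Q.refl)
      where
      x⋖y : x ⋖ y
      x⋖y rewrite row-cong x≈w | col-cong x≈w = w⋖y
    ...   | inj₂ (z , x⋖z , z≤w) = inj₂ (z , x⋖z , Q.trans z≤w (⋖⇒≤ w⋖y))

  weight-zero : ∀ {i j} → (∀ x → suc (row x) ≡ i → suc (col x) ≢ j) → weight i j ≡ 0
  weight-zero {i} {j} ∉ with weight i j ℕ.≟ 0
  ... | yes w≡0 = w≡0
  ... | no w≢0 = let x , p , q = weight-support i j (ℕ.≢-nonZero w≢0) in contradiction q (∉ x p)

-- Positions are composed with `f` and the weight table stays the same; surjectivity is used only to
-- produce elements, namely in `weight-support`, `bottom` and `top`.
pullback : ∀ {P Q} → P ≅ Q → Drawing Q → Drawing (FinitePoset.poset P)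
pullback {P} {Q} (f , iso) D = record
  { row            = D.row ∘ f
  ; col            = D.col ∘ f
  ; ≤⇒grid         = λ x≤y → D.≤⇒grid (f.mono x≤y)
  ; grid⇒≤         = λ p q → f.cancel (D.grid⇒≤ p q)
  ; weight         = D.weight
  ; weight-nonZero = D.weight-nonZero ∘ f
  ; weight-support = λ i j nz → let q , r , c = D.weight-support i j nz in
      f⁻¹ q , trans (cong suc (D.row-cong (f∘f⁻¹ q))) r , trans (cong suc (D.col-cong (f∘f⁻¹ q))) c
  ; lower          = λ x y → D.lower (f x) (f y)
  ; mesh           = D.mesh ∘ f
  ; balance        = D.balance ∘ f
  ; bottom         = f⁻¹ D.bottom
  ; top            = f⁻¹ D.top
  ; least          = λ x → f.cancel (Q.trans (Q.reflexive (f∘f⁻¹ D.bottom)) (D.least (f x)))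
  ; greatest       = λ x → f.cancel (Q.trans (D.greatest (f x)) (Q.reflexive (Q.Eq.sym (f∘f⁻¹ D.top))))
  ; symmetric      = trans (D.weightOf-cong (f∘f⁻¹ D.top))
                       (trans D.symmetric (sym (D.weightOf-cong (f∘f⁻¹ D.bottom))))
  }
  where
  module P = FinitePoset P
  module Q = Poset Q
  module D = Drawing D
  module f = IsOrderIsomorphism iso
  f⁻¹ : Q.Carrier → P.Carrier
  f⁻¹ q = proj₁ (f.surjective q)
  f∘f⁻¹ : ∀ q → f (f⁻¹ q) Q.≈ q
  f∘f⁻¹ q = proj₂ (f.surjective q) P.Eq.refl

-- The weighted toggle identity of a drawn poset, in natural numbers

module DrawnPoset (P : FinitePoset) (D : Drawing (FinitePoset.poset P)) where
  open FinitePoset P using (Carrier; _≈_; module Eq; size; enumeration; element; Maximal)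
  open Drawing D
  private module P = FinitePoset P

  index : Carrier → Fin size
  index = Inverse.from enumeration

  element-index : ∀ x → element (index x) ≈ x
  element-index = Inverse.strictlyInverseˡ enumeration

  element-injective : ∀ {k l} → element k ≈ element l → k ≡ l
  element-injective {k} {l} p = begin
    k                   ≡⟨ Inverse.strictlyInverseʳ enumeration k ⟨
    index (element k)   ≡⟨ Inverse.from-cong enumeration p ⟩
    index (element l)   ≡⟨ Inverse.strictlyInverseʳ enumeration l ⟩
    l                   ∎
    where open ≡-Reasoning

  -- Weights are indexed from 1, so the last occupied row is `1 + row top`; row `height` and column
  -- `width` are already border. Hence the squares include those with the top at either corner, and
  -- shifting an index by one loses nothing.
  height width : ℕ
  height = 2 + row top
  width  = 2 + col top

  ∑ : (Carrier → ℕ) → ℕ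
  ∑ f = sum (f ∘ element)

  ∑-cong : ∀ {f g} → (∀ x → f x ≡ g x) → ∑ f ≡ ∑ g
  ∑-cong f≡g = sum-cong-≗ (f≡g ∘ element)

  ∑-+ : ∀ f g → ∑ (λ x → f x + g x) ≡ ∑ f + ∑ g
  ∑-+ f g = ∑-distrib-+ (f ∘ element) (g ∘ element)

  ∑-single : ∀ y f → (∀ {x} → x ≈ y → f x ≡ f y) → (∀ x → ¬ x ≈ y → f x ≡ 0) → ∑ f ≡ f y
  ∑-single y f resp f≡0 = trans
    (sum-single (index y) (f ∘ element) λ k k≢ → f≡0 (element k) λ k≈y →
      k≢ (element-injective (Eq.trans k≈y (Eq.sym (element-index y)))))
    (resp (element-index y))

  ∑≡gridSum : ∀ f → (∀ i j → NonZero (f i j) → NonZero (weight (suc i) (suc j))) →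
              ∑ (λ x → f (row x) (col x)) ≡ gridSum height width f
  ∑≡gridSum f f⇒weight = sum≡gridSum height width (row ∘ element) (col ∘ element) f
    (λ k → s≤s (ℕ.m≤n⇒m≤1+n (proj₁ (≤⇒grid (greatest (element k))))))
    (λ k → s≤s (ℕ.m≤n⇒m≤1+n (proj₂ (≤⇒grid (greatest (element k))))))
    (λ p q → element-injective (grid-injective p q))
    λ i j nz → let x , p , q = weight-support _ _ (f⇒weight i j nz) in
      index x , trans (row-cong (element-index x)) (ℕ.suc-injective p)
              , trans (col-cong (element-index x)) (ℕ.suc-injective q)

  weight-firstRow : ∀ j → weight 0 j ≡ 0
  weight-firstRow j = weight-zero λ _ ()

  weight-firstCol : ∀ i → weight i 0 ≡ 0
  weight-firstCol i = weight-zero λ _ _ ()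

  weight-lastRow : ∀ j → weight height j ≡ 0
  weight-lastRow j = weight-zero λ x p _ →
    ℕ.1+n≰n (subst (_≤ row top) (ℕ.suc-injective p) (proj₁ (≤⇒grid (greatest x))))

  weight-lastCol : ∀ i → weight i width ≡ 0
  weight-lastCol i = weight-zero λ x _ q →
    ℕ.1+n≰n (subst (_≤ col top) (ℕ.suc-injective q) (proj₂ (≤⇒grid (greatest x))))

  mesh-at : ∀ i j → NonZero (weight i (suc j)) → NonZero (weight (suc i) j) →
            weight i j ≡ weight (suc i) (suc j)
  mesh-at i j u v with weight-support i (suc j) u
  ... | x , refl , refl = mesh x v

  source-cell : ∀ i j → NonZero (source (weight i (suc j)) (weight (suc i) j) (weight (suc i) (suc j))) →
                NonZero (weight (suc i) (suc j))
  source-cell i j nz with weight i (suc j) | weight (suc i) j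
  ... | zero | zero = nz

  -- Any other `x` lies above `bottom`, so `lowerCover` puts a neighbour at one of the two corners
  -- and the source vanishes; at `bottom` neither corner is occupied.
  source-sum : gridSum height width
                 (λ i j → source (weight i (suc j)) (weight (suc i) j) (weight (suc i) (suc j)))
               ≡ weightOf bottom
  source-sum = begin
    gridSum height width s               ≡⟨ ∑≡gridSum s source-cell ⟨
    ∑ (λ x → s (row x) (col x))          ≡⟨ ∑-single bottom _ s-cong s-off ⟩
    s (row bottom) (col bottom)          ≡⟨ s-bottom ⟩
    weightOf bottom                      ∎
    where
    open ≡-Reasoning
    s : ℕ → ℕ → ℕ
    s i j = source (weight i (suc j)) (weight (suc i) j) (weight (suc i) (suc j))

    s-cong : ∀ {x} → x ≈ bottom → s (row x) (col x) ≡ s (row bottom) (col bottom)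
    s-cong x≈b = cong₂ s (row-cong x≈b) (col-cong x≈b)

    source-zero : ∀ {u v} q → NonZero u ⊎ NonZero v → source u v q ≡ 0
    source-zero {suc _}        q _        = refl
    source-zero {zero} {suc _} q _        = refl
    source-zero {zero} {zero}  q (inj₁ u) = contradiction refl (ℕ.≢-nonZero⁻¹ 0 {{u}})
    source-zero {zero} {zero}  q (inj₂ v) = contradiction refl (ℕ.≢-nonZero⁻¹ 0 {{v}})

    ⋖⇒nonZero : ∀ {x y} → x ⋖ y →
      NonZero (weight (row y) (suc (col y))) ⊎ NonZero (weight (suc (row y)) (col y))
    ⋖⇒nonZero {x} {y} (inj₁ (p , q)) =
      inj₁ (≡.subst₂ (λ i j → NonZero (weight i (suc j))) p q (weight-nonZero x))
    ⋖⇒nonZero {x} {y} (inj₂ (p , q)) =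
      inj₂ (≡.subst₂ (λ i j → NonZero (weight (suc i) j)) p q (weight-nonZero x))

    s-off : ∀ x → ¬ x ≈ bottom → s (row x) (col x) ≡ 0
    s-off x x≉b with lowerCover (least x)
    ... | inj₁ b≈x           = contradiction (Eq.sym b≈x) x≉b
    ... | inj₂ (z , _ , z⋖x) = source-zero _ (⋖⇒nonZero z⋖x)

    source-present : ∀ u v q → ¬ NonZero u → ¬ NonZero v → source u v q ≡ q
    source-present zero    zero    q _  _  = refl
    source-present (suc _) v       q ¬u _  = contradiction _ ¬u
    source-present zero    (suc _) q _  ¬v = contradiction _ ¬v

    s-bottom : s (row bottom) (col bottom) ≡ weightOf bottom
    s-bottom = source-present _ _ _
      (λ u → let x , p , _ = weight-support _ _ u in
        ℕ.1+n≰n (ℕ.≤-trans (ℕ.≤-reflexive p) (proj₁ (≤⇒grid (least x)))))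
      (λ v → let x , _ , q = weight-support _ _ v in
        ℕ.1+n≰n (ℕ.≤-trans (ℕ.≤-reflexive q) (proj₂ (≤⇒grid (least x)))))

  ∑-* : ∀ n f → n * ∑ f ≡ ∑ (λ x → n * f x)
  ∑-* n f = *-distribˡ-sum n (f ∘ element)

  ∑-weighted : (f g h : Carrier → ℕ) → (∀ x → f x + g x ≡ h x) →
               ∑ (λ x → weightOf x * f x) + ∑ (λ x → weightOf x * g x) ≡ ∑ (λ x → weightOf x * h x)
  ∑-weighted f g h f+g≡h = trans
    (sym (∑-+ (λ x → weightOf x * f x) (λ x → weightOf x * g x)))
    (∑-cong λ x → trans (sym (ℕ.*-distribˡ-+ (weightOf x) (f x) (g x))) (cong (weightOf x *_) (f+g≡h x)))

  -- In the square from `(i , j)` to `(suc i , suc j)`, these are the multiplicities of the corners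
  -- `(i , suc j)` and `(suc i , j)`. The names tell on which side of the corner, by row number, the
  -- square lies: every point is such a corner of one square on each side.
  belowCoefficient aboveCoefficient : ℕ → ℕ → ℕ
  belowCoefficient i j = coefficient (weight (suc i) j) (weight i j) (weight (suc i) (suc j))
  aboveCoefficient i j = coefficient (weight i (suc j)) (weight i j) (weight (suc i) (suc j))

  module _ (I : OrderIdeal P) where
    open OrderIdeal I

    -- Membership as a predicate on points of the grid, indexed like the weights.
    Inside : ℕ → ℕ → Set
    Inside i j = ∃[ k ] ((suc (row (element k)) ≡ i × suc (col (element k)) ≡ j) × member (element k))

    inside? : ∀ i j → Dec (Inside i j)
    inside? i j = Fin.any? λ k → ((_ ℕ.≟ i) ×-dec (_ ℕ.≟ j)) ×-dec member? (element k)

    inside⇒weight : ∀ {i j} → Inside i j → NonZero (weight i j)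
    inside⇒weight (k , (refl , refl) , _) = weight-nonZero (element k)

    member⇒inside : ∀ {x i j} → suc (row x) ≡ i → suc (col x) ≡ j → member x → Inside i j
    member⇒inside {x} refl refl x∈I =
      index x , (cong suc (row-cong (element-index x)) , cong suc (col-cong (element-index x)))
              , member-resp (Eq.sym (element-index x)) x∈I

    inside⇒member : ∀ {x i j} → suc (row x) ≡ i → suc (col x) ≡ j → Inside i j → member x
    inside⇒member refl refl (k , (p , q) , k∈I) =
      member-resp (grid-injective (ℕ.suc-injective p) (ℕ.suc-injective q)) k∈I

    -- For the square with opposite corners (i,j) and (i+1,j+1): Filled says
    -- that I contains every lower cover of the latter, Touched that it
    -- contains some upper cover of the former.
    Filled Touched : ℕ → ℕ → Set
    Filled  i j = (NonZero (weight i (suc j)) → Inside i (suc j)) ×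
                  (NonZero (weight (suc i) j) → Inside (suc i) j)
    Touched i j = Inside i (suc j) ⊎ Inside (suc i) j

    filled? : ∀ i j → Dec (Filled i j)
    filled? i j = (ℕ.nonZero? _ →-dec inside? _ _) ×-dec (ℕ.nonZero? _ →-dec inside? _ _)

    touched? : ∀ i j → Dec (Touched i j)
    touched? i j = inside? _ _ ⊎-dec inside? _ _

    lower⇒filled : ∀ {x} → (∀ {z} → z ⋖ x → member z) → Filled (row x) (col x)
    lower⇒filled {x} h =
      (λ nz → let z , p , q = weight-support _ _ nz in
        member⇒inside p q (h (inj₁ (p , ℕ.suc-injective q)))) ,
      (λ nz → let z , p , q = weight-support _ _ nz in
        member⇒inside p q (h (inj₂ (ℕ.suc-injective p , q))))

    filled⇒lower : ∀ {x z} → Filled (row x) (col x) → z ⋖ x → member z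
    filled⇒lower {x} {z} (f , _) (inj₁ (p , q)) = inside⇒member p (cong suc q)
      (f (≡.subst₂ (λ i j → NonZero (weight i j)) p (cong suc q) (weight-nonZero z)))
    filled⇒lower {x} {z} (_ , f) (inj₂ (p , q)) = inside⇒member (cong suc p) q
      (f (≡.subst₂ (λ i j → NonZero (weight i j)) (cong suc p) q (weight-nonZero z)))

    touched⇒upper : ∀ {x} → Touched (suc (row x)) (suc (col x)) → ∃[ z ] (x ⋖ z × member z)
    touched⇒upper (inj₁ (k , (p , q) , k∈I)) =
      element k , inj₂ (sym (ℕ.suc-injective p) , sym (ℕ.suc-injective q)) , k∈I
    touched⇒upper (inj₂ (k , (p , q) , k∈I)) =
      element k , inj₁ (sym (ℕ.suc-injective p) , sym (ℕ.suc-injective q)) , k∈I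

    upper⇒touched : ∀ {x z} → x ⋖ z → member z → Touched (suc (row x)) (suc (col x))
    upper⇒touched (inj₁ (p , q)) z∈I = inj₂ (member⇒inside (cong suc (sym p)) (cong suc (sym q)) z∈I)
    upper⇒touched (inj₂ (p , q)) z∈I = inj₁ (member⇒inside (cong suc (sym p)) (cong suc (sym q)) z∈I)

    -- If all lower covers of `x` are in the ideal and `x` is not, then anything strictly below `x`
    -- is below a lower cover by `lowerCover`, hence inside; so `x` is minimal outside.
    minimal-identity : ∀ x → 𝟏 (minimalOutside? x) + 𝟏 (member? x) ≡ 𝟏 (filled? (row x) (col x))
    minimal-identity x = 𝟏-⊎ (minimalOutside? x) (member? x) (filled? _ _)
      proj₁
      -- Minimality only refutes `¬ member z`; decidability turns this into membership.
      (λ (_ , least) → lower⇒filled λ {z} z⋖x → decidable-stable (member? z) λ z∉I →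
        ⋖⇒≉ z⋖x (least z z∉I (⋖⇒≤ z⋖x)))
      (λ x∈I → lower⇒filled λ z⋖x → downClosed (⋖⇒≤ z⋖x) x∈I)
      λ filled x∉I → x∉I , λ y y∉I y≤x →
        [ (λ y≈x → y≈x)
        , (λ (z , y≤z , z⋖x) → contradiction (downClosed y≤z (filled⇒lower filled z⋖x)) y∉I)
        ]′ (lowerCover y≤x)

    -- Dual, with `upperCover`: a member strictly above `x` forces an upper cover of `x` into the
    -- ideal.
    maximal-identity : ∀ x → 𝟏 (maximalInside? x) + 𝟏 (touched? (suc (row x)) (suc (col x))) ≡ 𝟏 (member? x)
    maximal-identity x = 𝟏-⊎ (maximalInside? x) (touched? _ _) (member? x)
      (λ (_ , greatest) t → let z , x⋖z , z∈I = touched⇒upper t in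
        ⋖⇒≉ x⋖z (Eq.sym (greatest z z∈I (⋖⇒≤ x⋖z))))
      proj₁
      (λ t → let z , x⋖z , z∈I = touched⇒upper t in downClosed (⋖⇒≤ x⋖z) z∈I)
      λ x∈I ¬t → x∈I , λ y y∈I x≤y →
        [ Eq.sym
        , (λ (z , x⋖z , z≤y) → contradiction (upper⇒touched x⋖z (downClosed z≤y y∈I)) ¬t)
        ]′ (upperCover x≤y)

    -- Each element is the corner q of one square and the corner p of another. The first square has
    -- the weight at its far corner, the second at its near one, so only `touchedWeight` has to be
    -- shifted, in both indices, to become a sum over elements.
    filledWeight touchedWeight : ℕ → ℕ → ℕ
    filledWeight  i j = weight (suc i) (suc j) * 𝟏 (filled? i j)
    touchedWeight i j = weight i j * 𝟏 (touched? i j)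

    meshBelow meshAbove : ℕ → ℕ → ℕ
    meshBelow i j = belowCoefficient i j * 𝟏 (inside? i (suc j))
    meshAbove i j = aboveCoefficient i j * 𝟏 (inside? (suc i) j)

    touchedWeight-zero : ∀ i j → weight i j ≡ 0 → touchedWeight i j ≡ 0
    touchedWeight-zero i j = cong (_* 𝟏 (touched? i j))

    weight-outside : ∀ {i j} n → weight i j ≡ 0 → n * 𝟏 (inside? i j) ≡ 0
    weight-outside {i} {j} n w≡0 = trans
      (cong (n *_) (𝟏-false (inside? i j) λ p → ℕ.≢-nonZero⁻¹ _ {{inside⇒weight p}} w≡0))
      (ℕ.*-zeroʳ n)

    inside-member : ∀ x → 𝟏 (inside? (suc (row x)) (suc (col x))) ≡ 𝟏 (member? x)
    inside-member x = 𝟏-⇔ (inside? _ _) (member? x) (inside⇒member refl refl) (member⇒inside refl refl)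

    factor-nonZero : ∀ m n → NonZero (m * n) → NonZero m
    factor-nonZero (suc m) n nz = _

    insideWeight-nonZero : ∀ n {i j} → NonZero (n * 𝟏 (inside? i j)) → NonZero (weight i j)
    insideWeight-nonZero n nz = ℕ.≢-nonZero λ w≡0 →
      ℕ.≢-nonZero⁻¹ _ {{nz}} (weight-outside n w≡0)

    filled-sum : gridSum height width filledWeight ≡ ∑ (λ x → weightOf x * 𝟏 (filled? (row x) (col x)))
    filled-sum = sym (∑≡gridSum filledWeight λ i j → factor-nonZero (weight (suc i) (suc j)) _)

    touched-sum : gridSum height width touchedWeight ≡
                  ∑ (λ x → weightOf x * 𝟏 (touched? (suc (row x)) (suc (col x))))
    touched-sum = begin
      gridSum height width touchedWeight
        ≡⟨ gridSum-shiftRow height width touchedWeight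
             (λ j → touchedWeight-zero 0 j (weight-firstRow j))
             (λ j → touchedWeight-zero height j (weight-lastRow j)) ⟨
      gridSum height width (λ i j → touchedWeight (suc i) j)
        ≡⟨ gridSum-shiftCol height width (λ i j → touchedWeight (suc i) j)
             (λ i → touchedWeight-zero (suc i) 0 (weight-firstCol (suc i)))
             (λ i → touchedWeight-zero (suc i) width (weight-lastCol (suc i))) ⟨
      gridSum height width (λ i j → touchedWeight (suc i) (suc j))
        ≡⟨ ∑≡gridSum (λ i j → touchedWeight (suc i) (suc j)) (λ i j → factor-nonZero (weight (suc i) (suc j)) _) ⟨
      ∑ (λ x → weightOf x * 𝟏 (touched? (suc (row x)) (suc (col x)))) ∎
      where open ≡-Reasoning

    below-sum : gridSum height width meshBelow ≡ ∑ (λ x → meshBelow (suc (row x)) (col x))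
    below-sum = trans
      (sym (gridSum-shiftRow height width meshBelow
        (λ j → weight-outside (belowCoefficient 0 j) (weight-firstRow (suc j)))
        (λ j → weight-outside (belowCoefficient height j) (weight-lastRow (suc j)))))
      (sym (∑≡gridSum (λ i j → meshBelow (suc i) j)
        λ i j → insideWeight-nonZero (belowCoefficient (suc i) j)))

    above-sum : gridSum height width meshAbove ≡ ∑ (λ x → meshAbove (row x) (suc (col x)))
    above-sum = trans
      (sym (gridSum-shiftCol height width meshAbove
        (λ i → weight-outside (aboveCoefficient i 0) (weight-firstCol (suc i)))
        (λ i → weight-outside (aboveCoefficient i width) (weight-lastCol (suc i)))))
      (sym (∑≡gridSum (λ i j → meshAbove i (suc j))
        λ i j → insideWeight-nonZero (aboveCoefficient i (suc j))))

    mesh-sum : gridSum height width filledWeight + gridSum height width touchedWeight ≡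
               weightOf bottom + (gridSum height width meshBelow + gridSum height width meshAbove)
    mesh-sum = begin
      gridSum height width filledWeight + gridSum height width touchedWeight
        ≡⟨ gridSum-+ height width filledWeight touchedWeight ⟨
      gridSum height width (λ i j → filledWeight i j + touchedWeight i j)
        ≡⟨ gridSum-cong height width (λ i j → mesh-identity
             (weight i (suc j)) (weight (suc i) j) (weight i j) (weight (suc i) (suc j))
             (inside? i (suc j)) (inside? (suc i) j) inside⇒weight inside⇒weight (mesh-at i j)) ⟩
      gridSum height width (λ i j → s i j + (meshBelow i j + meshAbove i j))
        ≡⟨ gridSum-+ height width s (λ i j → meshBelow i j + meshAbove i j) ⟩
      gridSum height width s + gridSum height width (λ i j → meshBelow i j + meshAbove i j)
        ≡⟨ cong₂ _+_ source-sum (gridSum-+ height width meshBelow meshAbove) ⟩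
      weightOf bottom + (gridSum height width meshBelow + gridSum height width meshAbove) ∎
      where
      open ≡-Reasoning
      s : ℕ → ℕ → ℕ
      s i j = source (weight i (suc j)) (weight (suc i) j) (weight (suc i) (suc j))

    weightedMinimal weightedMaximal cardinality : ℕ
    weightedMinimal = ∑ λ x → weightOf x * 𝟏 (minimalOutside? x)
    weightedMaximal = ∑ λ x → weightOf x * 𝟏 (maximalInside? x)
    cardinality     = ∑ λ x → 𝟏 (member? x)

    private
      weightedMember : ℕ
      weightedMember = ∑ λ x → weightOf x * 𝟏 (member? x)

    minimal-sum : weightedMinimal + weightedMember ≡ gridSum height width filledWeight
    minimal-sum = trans
      (∑-weighted (𝟏 ∘ minimalOutside?) (𝟏 ∘ member?) (λ x → 𝟏 (filled? (row x) (col x))) minimal-identity)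
      (sym filled-sum)

    maximal-sum : weightedMaximal + gridSum height width touchedWeight ≡ weightedMember
    maximal-sum = trans (cong (weightedMaximal +_) touched-sum)
      (∑-weighted (𝟏 ∘ maximalInside?) (λ x → 𝟏 (touched? (suc (row x)) (suc (col x)))) (𝟏 ∘ member?)
        maximal-identity)

    balance-sum : (gridSum height width meshBelow + gridSum height width meshAbove) + 2 * cardinality
                  ≡ 2 * weightedMember
    balance-sum = begin
      (gridSum height width meshBelow + gridSum height width meshAbove) + 2 * cardinality
        ≡⟨ cong₂ _+_ (trans (cong₂ _+_ below-sum above-sum) (sym (∑-+ b a))) (∑-* 2 (𝟏 ∘ member?)) ⟩
      ∑ (λ x → b x + a x) + ∑ (λ x → 2 * 𝟏 (member? x))   ≡⟨ ∑-+ (λ x → b x + a x) (λ x → 2 * 𝟏 (member? x)) ⟨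
      ∑ (λ x → (b x + a x) + 2 * 𝟏 (member? x))           ≡⟨ ∑-cong pointwise ⟩
      ∑ (λ x → 2 * (weightOf x * 𝟏 (member? x)))          ≡⟨ ∑-* 2 (λ x → weightOf x * 𝟏 (member? x)) ⟨
      2 * weightedMember                                  ∎
      where
      open ≡-Reasoning
      b a : Carrier → ℕ
      b x = meshBelow (suc (row x)) (col x)
      a x = meshAbove (row x) (suc (col x))

      collect : ∀ m n k → m * k + n * k + 2 * k ≡ (m + n + 2) * k
      collect = solve-∀

      pointwise : ∀ x → (b x + a x) + 2 * 𝟏 (member? x) ≡ 2 * (weightOf x * 𝟏 (member? x))
      pointwise x rewrite inside-member x = begin
        m * k + n * k + 2 * k    ≡⟨ collect m n k ⟩
        (m + n + 2) * k          ≡⟨ cong (_* k) (balance x) ⟩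
        2 * weightOf x * k       ≡⟨ ℕ.*-assoc 2 (weightOf x) k ⟩
        2 * (weightOf x * k)     ∎
        where
        m = belowCoefficient (suc (row x)) (col x)
        n = aboveCoefficient (row x) (suc (col x))
        k = 𝟏 (member? x)

    -- The subtraction-free form of `∑ w (T⁺ - T⁻) = w(bottom) - 2 #I`. The total `M` of the corner
    -- terms links `mesh-sum` to `balance-sum` and is then cancelled.
    weighted-toggle : weightedMinimal + 2 * cardinality ≡ weightOf bottom + weightedMaximal
    weighted-toggle = ℕ.+-cancelʳ-≡ M _ _ $ begin
      weightedMinimal + 2 * cardinality + M          ≡⟨ rearrange₁ weightedMinimal (2 * cardinality) M ⟩
      weightedMinimal + (M + 2 * cardinality)        ≡⟨ cong (weightedMinimal +_) balance-sum ⟩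
      weightedMinimal + 2 * weightedMember           ≡⟨ rearrange₂ weightedMinimal weightedMember ⟩
      (weightedMinimal + weightedMember) + weightedMember   ≡⟨ cong₂ _+_ minimal-sum (sym maximal-sum) ⟩
      F + (weightedMaximal + G)                      ≡⟨ rearrange₄ F weightedMaximal G ⟩
      (F + G) + weightedMaximal                      ≡⟨ cong (_+ weightedMaximal) mesh-sum ⟩
      (weightOf bottom + M) + weightedMaximal        ≡⟨ rearrange₃ (weightOf bottom) M weightedMaximal ⟩
      weightOf bottom + weightedMaximal + M          ∎
      where
      open ≡-Reasoning
      M F G : ℕ
      M = gridSum height width meshBelow + gridSum height width meshAbove
      F = gridSum height width filledWeight
      G = gridSum height width touchedWeight
      rearrange₁ : ∀ p q r → p + q + r ≡ p + (r + q)
      rearrange₁ = solve-∀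
      rearrange₄ : ∀ p q r → p + (q + r) ≡ (p + r) + q
      rearrange₄ = solve-∀
      rearrange₂ : ∀ p q → p + 2 * q ≡ (p + q) + q
      rearrange₂ = solve-∀
      rearrange₃ : ∀ p q r → (p + q) + r ≡ p + r + q
      rearrange₃ = solve-∀

  wholePoset : OrderIdeal P
  wholePoset = record { member = λ _ → ⊤ ; member? = λ _ → yes tt ; downClosed = λ _ _ → tt }

  -- In Lie-theoretic terms this number is ⟨ϖ, 2ρ^∨⟩, the height of ϖ - w₀ϖ for the minuscule weight
  -- ϖ. Reading it off from the identity avoids counting the elements of each family.
  weight-bottom : weightOf bottom ≡ size
  weight-bottom = ℕ.*-cancelˡ-≡ _ _ 2 $ begin
    2 * weightOf bottom                       ≡⟨ double (weightOf bottom) ⟩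
    -- The surviving term belongs to `top`; `symmetric` makes it a second `weightOf bottom`.
    weightOf bottom + weightOf bottom         ≡⟨ cong (weightOf bottom +_) maximal ⟨
    weightOf bottom + weightedMaximal wholePoset            ≡⟨ weighted-toggle wholePoset ⟨
    weightedMinimal wholePoset + 2 * cardinality wholePoset ≡⟨ cong₂ _+_ minimal (cong (2 *_) (sum-const-1 size)) ⟩
    2 * size                                  ∎
    where
    open ≡-Reasoning
    open OrderIdeal wholePoset using (minimalOutside?; maximalInside?)
    
    double : ∀ n → 2 * n ≡ n + n
    double = solve-∀

    minimal : weightedMinimal wholePoset ≡ 0
    minimal = sum-zero {size} _ λ k → trans
      (cong (weightOf (element k) *_) (𝟏-false (minimalOutside? (element k)) λ (∉ , _) → ∉ tt))
      (ℕ.*-zeroʳ (weightOf (element k)))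

    top-maximal : ∀ {x} → x ≈ top → Maximal (λ _ → ⊤) x
    top-maximal x≈t = tt , λ y _ x≤y → P.antisym (P.trans (greatest y) (P.reflexive (Eq.sym x≈t))) x≤y

    maximal-at : ∀ {x} → x ≈ top → weightOf x * 𝟏 (maximalInside? x) ≡ weightOf bottom
    maximal-at {x} x≈t = begin
      weightOf x * 𝟏 (maximalInside? x)  ≡⟨ cong (weightOf x *_) (𝟏-true (maximalInside? x) (top-maximal x≈t)) ⟩
      weightOf x * 1                     ≡⟨ ℕ.*-identityʳ _ ⟩
      weightOf x                         ≡⟨ weightOf-cong x≈t ⟩
      weightOf top                       ≡⟨ symmetric ⟩
      weightOf bottom                    ∎

    maximal : weightedMaximal wholePoset ≡ weightOf bottom
    maximal = trans
      (∑-single top _ (λ x≈t → trans (maximal-at x≈t) (sym (maximal-at Eq.refl)))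
        λ x x≉t → trans
          (cong (weightOf x *_) (𝟏-false (maximalInside? x) λ (_ , max) →
            x≉t (Eq.sym (max top tt (greatest x)))))
          (ℕ.*-zeroʳ (weightOf x)))
      (maximal-at Eq.refl)

-- Passage to the field and division by two

module HalfWeights {a ℓ₁ ℓ₂} (K : CharZeroField a ℓ₁ ℓ₂)
                   (P : FinitePoset) (D : Drawing (FinitePoset.poset P)) where
  private
    module K = CharZeroField K
    module R = CommutativeRing K.commutativeRing
    module P = FinitePoset P
    open RingProperties R.ring using (-‿distribˡ-*)
    open SemiringMult R.semiring using (×-homo-+; ×1-homo-*)
    module S = SemiringSum R.semiring
  open K using (fromℕ)
  open Statistics K P
  open Drawing D using (weightOf)
  open DrawnPoset P D
    using (weightedMinimal; weightedMaximal; cardinality; weighted-toggle; weight-bottom)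
  open SetoidReasoning R.setoid

  fromℕ-+ : ∀ m n → fromℕ (m + n) R.≈ fromℕ m R.+ fromℕ n
  fromℕ-+ = ×-homo-+ R.1#

  fromℕ-* : ∀ m n → fromℕ (m * n) R.≈ fromℕ m R.* fromℕ n
  fromℕ-* = ×1-homo-*

  fromℕ-sum : ∀ {n} (f : Fin n → ℕ) → fromℕ (sum f) R.≈ K.∑ᶠ (fromℕ ∘ f)
  fromℕ-sum {zero}  f = R.refl
  fromℕ-sum {suc n} f = R.trans (fromℕ-+ (f Fin.zero) _) (R.+-congˡ (fromℕ-sum (f ∘ Fin.suc)))

  fromℕ-𝟏 : ∀ {A : Set} (A? : Dec A) → fromℕ (𝟏 A?) R.≈ [ A? ]
  fromℕ-𝟏 (yes _) = R.+-identityʳ R.1#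
  fromℕ-𝟏 (no _)  = R.refl

  half : R.Carrier
  half = proj₁ (K.#⇒invertible (K.charZero 2))

  two-halves : fromℕ 2 R.* half R.≈ R.1#
  two-halves = R.trans
    -- The inverse supplied by the field is that of `fromℕ 2 - 0#`, so the `- 0#` has to be
    -- inserted.
    (R.*-congʳ (R.sym (R.trans (R.+-congˡ -0#≈0#) (R.+-identityʳ _))))
    (proj₂ (proj₂ (K.#⇒invertible (K.charZero 2))))
    where open RingProperties R.ring using (-0#≈0#)

  halfWeight : P.Carrier → R.Carrier
  halfWeight x = fromℕ (weightOf x) R.* half

  weighted-sum : (f : P.Carrier → ℕ) (g : P.Carrier → R.Carrier) → (∀ x → fromℕ (f x) R.≈ g x) →
                 fromℕ (sum (λ k → weightOf (P.element k) * f (P.element k))) R.* half R.≈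
                 K.∑ᶠ (λ k → halfWeight (P.element k) R.* g (P.element k))
  weighted-sum f g f≈g = begin
    fromℕ (sum (wf ∘ P.element)) R.* half              ≈⟨ R.*-congʳ (fromℕ-sum (wf ∘ P.element)) ⟩
    K.∑ᶠ (fromℕ ∘ wf ∘ P.element) R.* half             ≈⟨ S.*-distribʳ-sum half (fromℕ ∘ wf ∘ P.element) ⟩
    K.∑ᶠ (λ k → fromℕ (wf (P.element k)) R.* half)     ≈⟨ S.sum-cong-≋ {P.size} (pointwise ∘ P.element) ⟩
    K.∑ᶠ (λ k → halfWeight (P.element k) R.* g (P.element k)) ∎
    where
    wf : P.Carrier → ℕ
    wf x = weightOf x * f x
    pointwise : ∀ x → fromℕ (wf x) R.* half R.≈ halfWeight x R.* g x
    pointwise x = begin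
      fromℕ (wf x) R.* half                              ≈⟨ R.*-congʳ (fromℕ-* (weightOf x) (f x)) ⟩
      fromℕ (weightOf x) R.* fromℕ (f x) R.* half        ≈⟨ R.*-assoc _ _ _ ⟩
      fromℕ (weightOf x) R.* (fromℕ (f x) R.* half)      ≈⟨ R.*-congˡ (R.*-comm _ _) ⟩
      fromℕ (weightOf x) R.* (half R.* fromℕ (f x))      ≈⟨ R.*-assoc _ _ _ ⟨
      halfWeight x R.* fromℕ (f x)                       ≈⟨ R.*-congˡ (f≈g x) ⟩
      halfWeight x R.* g x                               ∎

  cancelˡ : ∀ x y → R.- x R.+ (x R.+ y) R.≈ y
  cancelˡ x y = begin
    R.- x R.+ (x R.+ y)   ≈⟨ R.+-assoc _ _ _ ⟨
    R.- x R.+ x R.+ y     ≈⟨ R.+-congʳ (R.-‿inverseˡ x) ⟩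
    R.0# R.+ y            ≈⟨ R.+-identityˡ y ⟩
    y                     ∎

  -- Adding `w T⁺` turns `- w T` into `w T⁻`, which brings the claim to the subtraction-free shape
  -- of `weighted-toggle`.
  toggle-term : ∀ w p m → (R.- w R.* (p R.- m)) R.+ w R.* p R.≈ w R.* m
  toggle-term w p m = begin
    R.- w R.* (p R.- m) R.+ w R.* p
      ≈⟨ R.+-cong (R.sym (-‿distribˡ-* w _)) (R.*-congˡ (R.sym p-m+m≈p)) ⟩
    R.- (w R.* (p R.- m)) R.+ w R.* (p R.- m R.+ m)                ≈⟨ R.+-congˡ (R.distribˡ w _ m) ⟩
    R.- (w R.* (p R.- m)) R.+ (w R.* (p R.- m) R.+ w R.* m)        ≈⟨ cancelˡ _ _ ⟩
    w R.* m ∎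
    where
    p-m+m≈p : p R.- m R.+ m R.≈ p
    p-m+m≈p = R.trans (R.+-assoc p _ m) (R.trans (R.+-congˡ (R.-‿inverseˡ m)) (R.+-identityʳ p))

  ∑𝟙≋half : ∑ 𝟙 ≋ constant (K._/2 (fromℕ P.size))
  ∑𝟙≋half = (λ x → R.- halfWeight x) , λ I →
    let N = fromℕ P.size R.* half
        X = ∑ (λ x J → R.- halfWeight x R.* T x J) I
        T⁺-sum = ∑ (λ x J → halfWeight x R.* T⁺ x J) I
        T⁻-sum = ∑ (λ x J → halfWeight x R.* T⁻ x J) I

        X+T⁺≈T⁻ : X R.+ T⁺-sum R.≈ T⁻-sum
        X+T⁺≈T⁻ = R.trans (R.sym (S.∑-distrib-+ {P.size} _ _))
          (S.sum-cong-≋ {P.size} λ k → toggle-term (halfWeight (P.element k)) _ _)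

        T⁺≈ : fromℕ (weightedMinimal I) R.* half R.≈ T⁺-sum
        T⁺≈ = weighted-sum (λ x → 𝟏 (OrderIdeal.minimalOutside? I x)) (λ x → T⁺ x I)
                (λ x → fromℕ-𝟏 (OrderIdeal.minimalOutside? I x))

        T⁻≈ : fromℕ (weightedMaximal I) R.* half R.≈ T⁻-sum
        T⁻≈ = weighted-sum (λ x → 𝟏 (OrderIdeal.maximalInside? I x)) (λ x → T⁻ x I)
                (λ x → fromℕ-𝟏 (OrderIdeal.maximalInside? I x))

        𝟙≈ : fromℕ (2 * cardinality I) R.* half R.≈ ∑ 𝟙 I
        𝟙≈ = begin
          fromℕ (2 * cardinality I) R.* half               ≈⟨ R.*-congʳ (fromℕ-* 2 (cardinality I)) ⟩
          fromℕ 2 R.* fromℕ (cardinality I) R.* half       ≈⟨ R.*-congʳ (R.*-comm _ _) ⟩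
          fromℕ (cardinality I) R.* fromℕ 2 R.* half       ≈⟨ R.*-assoc _ _ _ ⟩
          fromℕ (cardinality I) R.* (fromℕ 2 R.* half)     ≈⟨ R.*-congˡ two-halves ⟩
          fromℕ (cardinality I) R.* R.1#                   ≈⟨ R.*-identityʳ _ ⟩
          fromℕ (cardinality I)                            ≈⟨ fromℕ-sum (λ k → 𝟏 (OrderIdeal.member? I (P.element k))) ⟩
          K.∑ᶠ (λ k → fromℕ (𝟏 (OrderIdeal.member? I (P.element k))))
            ≈⟨ S.sum-cong-≋ {P.size} (λ k → fromℕ-𝟏 (OrderIdeal.member? I (P.element k))) ⟩
          ∑ 𝟙 I                                            ∎

        halved : T⁺-sum R.+ ∑ 𝟙 I R.≈ N R.+ T⁻-sum
        halved = begin
          T⁺-sum R.+ ∑ 𝟙 I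
            ≈⟨ R.+-cong T⁺≈ 𝟙≈ ⟨
          fromℕ (weightedMinimal I) R.* half R.+ fromℕ (2 * cardinality I) R.* half
            ≈⟨ R.trans (R.*-congʳ (fromℕ-+ (weightedMinimal I) _)) (R.distribʳ _ _ _) ⟨
          fromℕ (weightedMinimal I + 2 * cardinality I) R.* half
            ≡⟨ cong (λ n → fromℕ n R.* half)
                 (trans (weighted-toggle I) (cong (_+ weightedMaximal I) weight-bottom)) ⟩
          fromℕ (P.size + weightedMaximal I) R.* half
            ≈⟨ R.trans (R.*-congʳ (fromℕ-+ P.size _)) (R.distribʳ _ _ _) ⟩
          N R.+ fromℕ (weightedMaximal I) R.* half
            ≈⟨ R.+-congˡ T⁻≈ ⟩
          N R.+ T⁻-sum ∎
    in begin
      ∑ 𝟙 I R.- N                              ≈⟨ R.+-congʳ (cancelˡ T⁺-sum (∑ 𝟙 I)) ⟨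
      R.- T⁺-sum R.+ (T⁺-sum R.+ ∑ 𝟙 I) R.- N  ≈⟨ R.+-congʳ (R.+-congˡ (R.trans halved (R.+-congˡ (R.sym X+T⁺≈T⁻)))) ⟩
      R.- T⁺-sum R.+ (N R.+ (X R.+ T⁺-sum)) R.- N  ≈⟨ cancel T⁺-sum N X ⟩
      X                                        ∎
    where
    cancel : ∀ t n x → R.- t R.+ (n R.+ (x R.+ t)) R.- n R.≈ x
    cancel t n x = begin
      R.- t R.+ (n R.+ (x R.+ t)) R.- n   ≈⟨ R.+-congʳ (R.+-congˡ (R.trans (R.sym (R.+-assoc n x t)) (R.+-comm _ t))) ⟩
      R.- t R.+ (t R.+ (n R.+ x)) R.- n   ≈⟨ R.+-congʳ (cancelˡ t _) ⟩
      n R.+ x R.- n                       ≈⟨ R.+-comm _ _ ⟩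
      R.- n R.+ (n R.+ x)                 ≈⟨ cancelˡ n x ⟩
      x                                   ∎

-- Tools for explicit weight tables

∸-step : ∀ {m n} → m < n → n ∸ m ≡ suc (n ∸ suc m)
∸-step {zero}  {suc n} _         = refl
∸-step {suc m} {suc n} (s≤s m<n) = ∸-step m<n

coefficient-≡ : ∀ {o p q d} → (NonZero o → q ≡ d) → (o ≡ 0 → p + q ≡ d) → coefficient o p q ≡ d
coefficient-≡ {zero}  _ h = h refl
coefficient-≡ {suc _} h _ = h _

module Masked {S : ℕ → ℕ → Set} (S? : ∀ i j → Dec (S i j)) (g : ℕ → ℕ → ℕ) where

  -- `S` and `g` use coordinates from 0, the result those from 1, with row 0 and column 0 as zero
  -- border.
  masked : ℕ → ℕ → ℕ
  masked zero    _       = 0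
  masked (suc _) zero    = 0
  masked (suc i) (suc j) = if does (S? i j) then g i j else 0

  masked-on : ∀ {i j} → S i j → masked (suc i) (suc j) ≡ g i j
  masked-on {i} {j} = if-yes (S? i j)

  masked-off : ∀ i j → ¬ S i j → masked (suc i) (suc j) ≡ 0
  masked-off i j = if-no (S? i j)

  masked-nonZero : ∀ {i j} → S i j → NonZero (g i j) → NonZero (masked (suc i) (suc j))
  masked-nonZero s nz = subst NonZero (sym (masked-on s)) nz

  masked-support : ∀ {i j} → NonZero (masked (suc i) (suc j)) → S i j
  masked-support {i} {j} nz with S? i j
  ... | yes s = s

-- Rectangles: type A

module Rectangle (a b : ℕ) where

  -- With `N = a + b`, the element at `(i , j)` has the label `k = i - j + b`, whose coefficient in
  -- 2ρ^∨ is `k (N - k)`. The factors are `k` and `N - k`, arranged so that truncated subtraction is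
  -- exact inside the rectangle.
  open Masked {λ i j → i < a × j < b} (λ i j → (i ℕ.<? a) ×-dec (j ℕ.<? b))
              (λ i j → (suc i + (b ∸ suc j)) * (suc j + (a ∸ suc i))) public
    renaming (masked to weight)

  -- `(k + 1) (N - k - 1)`, the value for the next label; it is 0 beyond the end of the diagram.
  belowValue : ℕ → ℕ → ℕ
  belowValue i j = (2 + i + (b ∸ suc j)) * (j + (a ∸ suc i))

  last-off : ∀ {i} j → ¬ suc i < a → weight (2 + i) j ≡ 0
  last-off zero    _ = refl
  last-off {i} (suc j) p = masked-off (suc i) j λ (q , _) → p q

  next-row : ∀ {i j} → suc i < a → j < b → weight (2 + i) (suc j) ≡ belowValue i j
  next-row {i} {j} i<a j<b rewrite ∸-step i<a = trans (masked-on (i<a , j<b))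
    (cong ((2 + i + (b ∸ suc j)) *_) (sym (ℕ.+-suc j (a ∸ (2 + i)))))

  previous-col : ∀ {i j} → i < a → suc j < b → weight (suc i) (suc j) ≡ belowValue i (suc j)
  previous-col {i} {j} i<a j<b = trans (masked-on (i<a , ℕ.<⇒≤ j<b))
    (cong (_* (suc j + (a ∸ suc i))) (trans (cong (suc i +_) (∸-step j<b)) (ℕ.+-suc (suc i) _)))

  -- The next label is found in the next row or, along the last row, in the previous column. Where
  -- neither exists, `i = a - 1` and `j = 0`, and `belowValue` is 0.
  below : ∀ {i j} → i < a → j < b →
          coefficient (weight (2 + i) j) (weight (1 + i) j) (weight (2 + i) (1 + j)) ≡ belowValue i j
  below {i} {j} i<a j<b with suc i ℕ.<? a
  below {i} {zero}  i<a j<b | yes i′<a = next-row i′<a j<b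
  below {i} {suc j} i<a j<b | yes i′<a = coefficient-≡ (λ _ → next-row i′<a j<b)
    λ o≡0 → contradiction o≡0 (ℕ.≢-nonZero⁻¹ _ {{masked-nonZero (i′<a , ℕ.<⇒≤ j<b) _}})
  below {i} {zero}  i<a j<b | no i′≮a = trans (last-off 1 i′≮a) (sym (trans
    (cong ((2 + i + (b ∸ 1)) *_) (ℕ.m≤n⇒m∸n≡0 (ℕ.≮⇒≥ i′≮a))) (ℕ.*-zeroʳ (2 + i + (b ∸ 1)))))
  below {i} {suc j} i<a j<b | no i′≮a = coefficient-≡
    (λ nz → contradiction (last-off (suc j) i′≮a) (ℕ.≢-nonZero⁻¹ _ {{nz}}))
    λ _ → trans (cong₂ _+_ (previous-col i<a j<b) (last-off (2 + j) i′≮a)) (ℕ.+-identityʳ _)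

-- Lets the half of `balance` on the other side follow from `below` for the transposed rectangle.
weight-transpose : ∀ a b i j → Rectangle.weight a b i j ≡ Rectangle.weight b a j i
weight-transpose a b zero    zero    = refl
weight-transpose a b zero    (suc j) = refl
weight-transpose a b (suc i) zero    = refl
weight-transpose a b (suc i) (suc j) = cong₂ (λ c n → if c then n else 0)
  (∧-comm (i ℕ.<ᵇ a) (j ℕ.<ᵇ b)) (ℕ.*-comm (suc i + (b ∸ suc j)) _)

drawRectangle : ∀ a b → .{{NonZero a}} → .{{NonZero b}} → Drawing (rectangle a b)
drawRectangle a@(suc a′) b@(suc b′) = record
  { row            = λ (i , _) → toℕ i
  ; col            = λ (_ , j) → toℕ j
  ; ≤⇒grid         = λ p → p
  ; grid⇒≤         = _,_
  ; weight         = weight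
  ; weight-nonZero = λ (i , j) → masked-nonZero (Fin.toℕ<n i , Fin.toℕ<n j) _
  ; weight-support = support
  ; lower          = lower
  ; mesh           = λ (i , j) → mesh (Fin.toℕ<n j)
  ; balance        = λ (i , j) → balance (Fin.toℕ<n i) (Fin.toℕ<n j)
  ; bottom         = Fin.zero , Fin.zero
  ; top            = Fin.fromℕ a′ , Fin.fromℕ b′
  ; least          = λ _ → z≤n , z≤n
  ; greatest       = λ (i , j) → Fin.≤fromℕ i , Fin.≤fromℕ j
  ; symmetric      = symmetric
  }
  where
  open Rectangle a b

  support : ∀ i j → NonZero (weight i j) →
            ∃[ x ] (suc (toℕ (proj₁ x)) ≡ i × suc (toℕ (proj₂ x)) ≡ j)
  support (suc i) (suc j) nz = let p , q = masked-support nz in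
    (fromℕ< p , fromℕ< q) , cong suc (Fin.toℕ-fromℕ< p) , cong suc (Fin.toℕ-fromℕ< q)

  predecessor : ∀ {i} (k : Fin a) → i < toℕ k → ∀ {j} → j < b → NonZero (weight (toℕ k) (suc j))
  predecessor (Fin.suc k) _ q = masked-nonZero (ℕ.m≤n⇒m≤1+n (Fin.toℕ<n k) , q) _

  predecessor′ : ∀ {j} (k : Fin b) → j < toℕ k → ∀ {i} → i < a → NonZero (weight (suc i) (toℕ k))
  predecessor′ (Fin.suc k) _ p = masked-nonZero (p , ℕ.m≤n⇒m≤1+n (Fin.toℕ<n k)) _

  lower : ∀ ((i , j) (k , l) : Fin a × Fin b) → toℕ i ≤ toℕ k → toℕ j ≤ toℕ l →
          (toℕ i ≡ toℕ k × toℕ j ≡ toℕ l) ⊎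
          (toℕ i < toℕ k × NonZero (weight (toℕ k) (suc (toℕ l)))) ⊎
          (toℕ j < toℕ l × NonZero (weight (suc (toℕ k)) (toℕ l)))
  lower (i , j) (k , l) p q with ℕ.m≤n⇒m<n∨m≡n p | ℕ.m≤n⇒m<n∨m≡n q
  ... | inj₁ i<k | _        = inj₂ (inj₁ (i<k , predecessor k i<k (Fin.toℕ<n l)))
  ... | inj₂ _   | inj₁ j<l = inj₂ (inj₂ (j<l , predecessor′ l j<l (Fin.toℕ<n k)))
  ... | inj₂ i≡k | inj₂ j≡l = inj₁ (i≡k , j≡l)

  mesh : ∀ {i j} → j < b → NonZero (weight (2 + i) j) → weight (1 + i) j ≡ weight (2 + i) (1 + j)
  mesh {i} {suc j} j<b nz = let i<a , _ = masked-support nz in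
    trans (previous-col (ℕ.<⇒≤ i<a) j<b) (sym (next-row i<a j<b))

  balance : ∀ {i j} → i < a → j < b →
    (coefficient (weight (2 + i) j) (weight (1 + i) j) (weight (2 + i) (1 + j)) +
     coefficient (weight i (2 + j)) (weight i (1 + j)) (weight (1 + i) (2 + j))) + 2
    ≡ 2 * weight (1 + i) (1 + j)
  balance {i} {j} i<a j<b
    rewrite below i<a j<b
          | weight-transpose a b i (2 + j) | weight-transpose a b i (1 + j)
          | weight-transpose a b (1 + i) (2 + j)
          | Rectangle.below b a j<b i<a
          | masked-on {i} {j} (i<a , j<b) = concave i j (b ∸ suc j) (a ∸ suc i)
    where
    -- The second difference of `k (N - k)` is -2, with `k = suc i + B` and `N - k = suc j + A`.
    concave : ∀ i j B A → ((2 + i + B) * (j + A) + (2 + j + A) * (i + B)) + 2 ≡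
                          2 * ((suc i + B) * (suc j + A))
    concave = solve-∀

  symmetric : weight (suc (toℕ (Fin.fromℕ a′))) (suc (toℕ (Fin.fromℕ b′))) ≡ weight 1 1
  symmetric rewrite Fin.toℕ-fromℕ a′ | Fin.toℕ-fromℕ b′ = trans
    (masked-on (ℕ.≤-refl , ℕ.≤-refl))
    (trans (cong₂ _*_ (trans (cong (a +_) (ℕ.n∸n≡0 b′)) (ℕ.+-identityʳ a))
                      (trans (cong (b +_) (ℕ.n∸n≡0 a′)) (ℕ.+-identityʳ b)))
           (trans (ℕ.*-comm a b) (sym (masked-on (s≤s z≤n , s≤s z≤n)))))

-- Shifted staircases: type D with a spin node

triangular : ℕ → ℕ
triangular zero    = 0
triangular (suc n) = suc n + triangular n

2*triangular : ∀ n → 2 * triangular n ≡ n * suc n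
2*triangular zero    = refl
2*triangular (suc n) = begin
  2 * (suc n + triangular n)       ≡⟨ ℕ.*-distribˡ-+ 2 (suc n) (triangular n) ⟩
  2 * suc n + 2 * triangular n     ≡⟨ cong (2 * suc n +_) (2*triangular n) ⟩
  2 * suc n + n * suc n            ≡⟨ ℕ.*-distribʳ-+ (suc n) 2 n ⟨
  (2 + n) * suc n                  ≡⟨ ℕ.*-comm (2 + n) (suc n) ⟩
  suc n * suc (suc n)              ∎
  where open ≡-Reasoning

module Staircase (n : ℕ) where

  -- Coefficients of 2ρ^∨ in type D with `n + 1` nodes. The main diagonal alternates between the two
  -- spin nodes, both with `n (n + 1) / 2`; the k-th diagonal above it carries node `n - k` of the
  -- long arm, with `(n - k) (n + 1 + k)`.
  diagonal : ℕ → ℕ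
  diagonal zero    = triangular n
  diagonal (suc k) = (n ∸ suc k) * suc (n + suc k)

  open Masked {λ i j → i ≤ j × j < n} (λ i j → (i ℕ.≤? j) ×-dec (j ℕ.<? n))
              (λ i j → diagonal (j ∸ i)) public
    renaming (masked to weight)

  diagonal-nonZero : ∀ k → k < n → NonZero (diagonal k)
  diagonal-nonZero zero    (s≤s _) = _
  diagonal-nonZero (suc k) k<n rewrite ∸-step k<n = _

  cell-nonZero : ∀ {i j} → i ≤ j → j < n → NonZero (weight (suc i) (suc j))
  cell-nonZero {i} {j} i≤j j<n =
    masked-nonZero (i≤j , j<n) (diagonal-nonZero (j ∸ i) (ℕ.≤-<-trans (ℕ.m∸n≤m j i) j<n))

  cell : ∀ i k → i + k < n → weight (suc i) (suc (i + k)) ≡ diagonal k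
  cell i k p = trans (masked-on (ℕ.m≤m+n i k , p)) (cong diagonal (ℕ.m+n∸m≡n i k))

  diagonal-cell : ∀ {i} → i < n → weight (suc i) (suc i) ≡ diagonal 0
  diagonal-cell {i} p = trans (masked-on (ℕ.≤-refl , p)) (cong diagonal (ℕ.n∸n≡0 i))

  off-diagonal : ∀ i → weight (2 + i) (suc i) ≡ 0
  off-diagonal i = masked-off (suc i) i λ (p , _) → ℕ.1+n≰n p

  off-column : ∀ i {j} → ¬ j < n → weight i (suc j) ≡ 0
  off-column zero    _ = refl
  off-column (suc i) {j} p = masked-off i j λ (_ , q) → p q

  -- The neighbours of a label towards the main diagonal: none for a spin node, both spin nodes for
  -- the branch node, one node on the rest of the arm. At `k = 1` the fourth corner lies below the
  -- diagonal, so both weights count.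
  belowValue : ℕ → ℕ
  belowValue zero          = 0
  belowValue (suc zero)    = 2 * diagonal 0
  belowValue (suc (suc k)) = diagonal (suc k)

  below : ∀ i k → i + k < n →
          coefficient (weight (2 + i) (i + k)) (weight (1 + i) (i + k)) (weight (2 + i) (1 + (i + k)))
          ≡ belowValue k
  below i zero p rewrite ℕ.+-identityʳ i = coefficient-≡ {weight (2 + i) i} (λ _ → off-diagonal i) (λ _ → zero-sum i)
    where
    zero-sum : ∀ i → weight (1 + i) i + weight (2 + i) (1 + i) ≡ 0
    zero-sum zero    = off-diagonal zero
    zero-sum (suc i) = cong₂ _+_ (off-diagonal i) (off-diagonal (suc i))
  below i (suc zero) p rewrite ℕ.+-suc i 0 | ℕ.+-identityʳ i = coefficient-≡
    (λ nz → contradiction (off-diagonal i) (ℕ.≢-nonZero⁻¹ _ {{nz}}))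
    λ _ → cong₂ _+_ (diagonal-cell (ℕ.<⇒≤ p)) (trans (diagonal-cell p) (sym (ℕ.+-identityʳ (diagonal 0))))
  below i (suc (suc k)) p rewrite ℕ.+-suc i (suc k) = coefficient-≡
    (λ _ → cell (suc i) (suc k) p)
    λ o≡0 → contradiction o≡0 (ℕ.≢-nonZero⁻¹ _ {{cell-nonZero
      (ℕ.≤-trans (s≤s (ℕ.m≤m+n i k)) (ℕ.≤-reflexive (sym (ℕ.+-suc i k)))) (ℕ.<⇒≤ p)}})

  -- In the last column the value comes from the neighbour in the previous row. In row 0 there is
  -- none, but then `suc k = n` and `diagonal n` is 0.
  above : ∀ i k → i + k < n →
          coefficient (weight i (2 + (i + k))) (weight i (1 + (i + k))) (weight (1 + i) (2 + (i + k)))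
          ≡ diagonal (suc k)
  above i k p with suc (i + k) ℕ.<? n
  above zero    k p | yes q = cell 0 (suc k) q
  above (suc i) k p | yes q = coefficient-≡
    (λ _ → trans (cong (λ j → weight (2 + i) (suc j)) (sym (ℕ.+-suc (suc i) k)))
                 (cell (suc i) (suc k) (subst (_< n) (sym (ℕ.+-suc (suc i) k)) q)))
    λ o≡0 → contradiction o≡0 (ℕ.≢-nonZero⁻¹ _ {{cell-nonZero
      (ℕ.m≤n⇒m≤1+n (ℕ.m≤n⇒m≤1+n (ℕ.m≤m+n i k))) q}})
  above zero    k p | no ¬q = trans (off-column 1 ¬q)
    (sym (cong (_* suc (n + suc k)) (ℕ.m≤n⇒m∸n≡0 (ℕ.≮⇒≥ ¬q))))
  above (suc i) k p | no ¬q = coefficient-≡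
    (λ nz → contradiction (off-column (suc i) ¬q) (ℕ.≢-nonZero⁻¹ _ {{nz}}))
    λ _ → trans (cong₂ _+_
      (trans (cong (λ j → weight (suc i) (suc j)) (sym (ℕ.+-suc i k)))
             (cell i (suc k) (subst (_< n) (sym (ℕ.+-suc i k)) p)))
      (off-column (2 + i) ¬q)) (ℕ.+-identityʳ _)

  -- The three cases are a spin node, the branch node, and the rest of the long arm.
  diagonal-balance : ∀ k → k < n → (belowValue k + diagonal (suc k)) + 2 ≡ 2 * diagonal k
  diagonal-balance zero k<n = begin
    diagonal 1 + 2                    ≡⟨ cong (λ n → (n ∸ 1) * suc (n + 1) + 2) n≡ ⟩
    m * suc (suc m + 1) + 2           ≡⟨ identity m ⟩
    suc m * suc (suc m)               ≡⟨ cong (λ n → n * suc n) n≡ ⟨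
    n * suc n                         ≡⟨ 2*triangular n ⟨
    2 * triangular n                  ∎
    where
    open ≡-Reasoning
    m = n ∸ 1
    n≡ : n ≡ suc m
    n≡ = ∸-step k<n
    identity : ∀ m → m * suc (suc m + 1) + 2 ≡ suc m * suc (suc m)
    identity = solve-∀
  diagonal-balance (suc zero) k<n = begin
    2 * triangular n + diagonal 2 + 2              ≡⟨ cong (λ m → m + diagonal 2 + 2) (2*triangular n) ⟩
    n * suc n + diagonal 2 + 2                     ≡⟨ cong (λ n → n * suc n + (n ∸ 2) * suc (n + 2) + 2) n≡ ⟩
    (2 + m) * (3 + m) + m * suc (2 + m + 2) + 2    ≡⟨ identity m ⟩
    2 * (suc m * suc (2 + m + 1))                  ≡⟨ cong (λ n → 2 * ((n ∸ 1) * suc (n + 1))) n≡ ⟨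
    2 * diagonal 1                                 ∎
    where
    open ≡-Reasoning
    m = n ∸ 2
    n≡ : n ≡ 2 + m
    n≡ = sym (ℕ.m+[n∸m]≡n k<n)
    identity : ∀ m → (2 + m) * (3 + m) + m * suc (2 + m + 2) + 2 ≡ 2 * (suc m * suc (2 + m + 1))
    identity = solve-∀
  diagonal-balance (suc (suc k)) k<n rewrite ∸-step (ℕ.<⇒≤ k<n) | ∸-step k<n =
    identity n k (n ∸ (3 + k))
    where
    identity : ∀ n k m → (2 + m) * suc (n + suc k) + m * suc (n + (3 + k)) + 2 ≡
                         2 * (suc m * suc (n + (2 + k)))
    identity = solve-∀

  mesh : ∀ {i j} → i ≤ j → j < n → NonZero (weight (2 + i) j) → weight (1 + i) j ≡ weight (2 + i) (1 + j)
  mesh {i} {suc j} i≤j j<n nz = let i<j , _ = masked-support nz in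
    trans (masked-on (ℕ.<⇒≤ i<j , ℕ.<⇒≤ j<n)) (sym (masked-on (ℕ.m≤n⇒m≤1+n i<j , j<n)))

  balance : ∀ {i j} → i ≤ j → j < n →
    (coefficient (weight (2 + i) j) (weight (1 + i) j) (weight (2 + i) (1 + j)) +
     coefficient (weight i (2 + j)) (weight i (1 + j)) (weight (1 + i) (2 + j))) + 2
    ≡ 2 * weight (1 + i) (1 + j)
  balance {i} i≤j j<n with k , refl ← ℕ.m≤n⇒∃[o]m+o≡n i≤j
    rewrite below i k j<n | above i k j<n | cell i k j<n =
    diagonal-balance k (ℕ.≤-<-trans (ℕ.m≤n+m k i) j<n)

drawStaircase : ∀ n → .{{NonZero n}} → Drawing (shiftedStaircase n)
drawStaircase n@(suc n′) = record
  { row            = λ ((i , _) , _) → toℕ i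
  ; col            = λ ((_ , j) , _) → toℕ j
  ; ≤⇒grid         = λ p → p
  ; grid⇒≤         = _,_
  ; weight         = weight
  ; weight-nonZero = λ ((_ , j) , i≤j) → cell-nonZero i≤j (Fin.toℕ<n j)
  ; weight-support = support
  ; lower          = lower
  ; mesh           = λ ((_ , j) , i≤j) → mesh i≤j (Fin.toℕ<n j)
  ; balance        = λ ((_ , j) , i≤j) → balance i≤j (Fin.toℕ<n j)
  ; bottom         = (Fin.zero , Fin.zero) , z≤n
  ; top            = (Fin.fromℕ n′ , Fin.fromℕ n′) , ℕ.≤-refl
  ; least          = λ _ → z≤n , z≤n
  ; greatest       = λ ((i , j) , _) → Fin.≤fromℕ i , Fin.≤fromℕ j
  ; symmetric      = trans (corner (Fin.fromℕ n′)) (sym (corner Fin.zero))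
  }
  where
  open Staircase n

  corner : ∀ i → weight (suc (toℕ i)) (suc (toℕ i)) ≡ diagonal 0
  corner i = diagonal-cell (Fin.toℕ<n i)

  support : ∀ i j → NonZero (weight i j) →
            ∃[ x ] (suc (toℕ (proj₁ (proj₁ x))) ≡ i × suc (toℕ (proj₂ (proj₁ x))) ≡ j)
  support (suc i) (suc j) nz =
    let p , q = masked-support nz
        i≡ = Fin.toℕ-fromℕ< (ℕ.≤-<-trans p q)
        j≡ = Fin.toℕ-fromℕ< q
    in ((fromℕ< (ℕ.≤-<-trans p q) , fromℕ< q) , ≡.subst₂ _≤_ (sym i≡) (sym j≡) p) , cong suc i≡ , cong suc j≡

  upward : ∀ {i k l} → i < k → k ≤ l → l < n → NonZero (weight k (suc l))
  upward {k = suc k} _ p q = cell-nonZero (ℕ.<⇒≤ p) q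

  leftward : ∀ {j k l} → k ≤ j → j < l → l < n → NonZero (weight (suc k) l)
  leftward {l = suc l} p j<l q = cell-nonZero (ℕ.≤-trans p (ℕ.≤-pred j<l)) (ℕ.<⇒≤ q)

  lower : ∀ (x y : Poset.Carrier (shiftedStaircase n)) →
          let ((i , j) , _) = x; ((k , l) , _) = y in
          toℕ i ≤ toℕ k → toℕ j ≤ toℕ l →
          (toℕ i ≡ toℕ k × toℕ j ≡ toℕ l) ⊎
          (toℕ i < toℕ k × NonZero (weight (toℕ k) (suc (toℕ l)))) ⊎
          (toℕ j < toℕ l × NonZero (weight (suc (toℕ k)) (toℕ l)))
  lower ((i , j) , i≤j) ((k , l) , k≤l) p q with ℕ.m≤n⇒m<n∨m≡n p | ℕ.m≤n⇒m<n∨m≡n q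
  ... | inj₁ i<k | _        = inj₂ (inj₁ (i<k , upward i<k k≤l (Fin.toℕ<n l)))
  ... | inj₂ i≡k | inj₁ j<l = inj₂ (inj₂ (j<l , leftward (subst (_≤ toℕ j) i≡k i≤j) j<l (Fin.toℕ<n l)))
  ... | inj₂ i≡k | inj₂ j≡l = inj₁ (i≡k , j≡l)

-- Double-tailed diamonds: type D with the end node of the long arm

drawDoubleTailedDiamond : ∀ m → Drawing (doubleTailedDiamond (2 + m))
drawDoubleTailedDiamond m = record
  { row            = row
  ; col            = col
  ; ≤⇒grid         = ⊑⇒grid
  ; grid⇒≤         = λ {x} {y} → grid⇒⊑ x y
  ; weight         = weight
  ; weight-nonZero = weight-nonZero
  ; weight-support = support
  ; lower          = lower
  ; mesh           = mesh
  ; balance        = balance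
  ; bottom         = x Fin.zero
  ; top            = z Fin.zero
  ; least          = least
  ; greatest       = greatest
  ; symmetric      = trans (weight-z ℕ.≤-refl) (trans (cong arm (ℕ.n∸n≡0 m)) (sym (weight-x z≤n)))
  }
  where
  open Defs using (x; y₁; y₂; z)
  D : Set
  D = Diamond (2 + m)

  -- A hook: the x's and then `y₁` run along row 0, the z's down column `suc m`, and `y₂` sits
  -- inside the bend. The only full unit square consists of the last x, `y₁`, `y₂` and the least z.
  -- Since the z's decrease with the index, their rows are reversed.
  row col : D → ℕ
  row (x i) = 0
  row y₁    = 0
  row y₂    = 1
  row (z k) = suc (m ∸ toℕ k)
  col (x i) = toℕ i
  col y₁    = suc m
  col y₂    = m
  col (z k) = suc m

  ≤m : (i : Fin (suc m)) → toℕ i ≤ m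
  ≤m i = ℕ.≤-pred (Fin.toℕ<n i)

  ⊑⇒grid : ∀ {p q : D} → p ⊑ q → row p ≤ row q × col p ≤ col q
  ⊑⇒grid (x⊑x p)   = z≤n , p
  ⊑⇒grid {x i} x⊑y₁ = z≤n , ℕ.m≤n⇒m≤1+n (≤m i)
  ⊑⇒grid {x i} x⊑y₂ = z≤n , ≤m i
  ⊑⇒grid {x i} x⊑z  = z≤n , ℕ.m≤n⇒m≤1+n (≤m i)
  ⊑⇒grid y₁⊑y₁     = ℕ.≤-refl , ℕ.≤-refl
  ⊑⇒grid y₂⊑y₂     = ℕ.≤-refl , ℕ.≤-refl
  ⊑⇒grid y₁⊑z      = z≤n , ℕ.≤-refl
  ⊑⇒grid y₂⊑z      = s≤s z≤n , ℕ.n≤1+n m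
  ⊑⇒grid (z⊑z p)   = s≤s (ℕ.∸-monoʳ-≤ m p) , ℕ.≤-refl

  grid⇒⊑ : ∀ (p q : D) → row p ≤ row q → col p ≤ col q → p ⊑ q
  grid⇒⊑ (x i) (x j) _       c = x⊑x c
  grid⇒⊑ (x i) y₁    _       _ = x⊑y₁
  grid⇒⊑ (x i) y₂    _       _ = x⊑y₂
  grid⇒⊑ (x i) (z k) _       _ = x⊑z
  grid⇒⊑ y₁    (x j) _       c = contradiction (ℕ.≤-trans c (≤m j)) ℕ.1+n≰n
  grid⇒⊑ y₁    y₁    _       _ = y₁⊑y₁
  grid⇒⊑ y₁    y₂    _       c = contradiction c ℕ.1+n≰n
  grid⇒⊑ y₁    (z k) _       _ = y₁⊑z
  grid⇒⊑ y₂    y₂    _       _ = y₂⊑y₂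
  grid⇒⊑ y₂    (z k) _       _ = y₂⊑z
  grid⇒⊑ (z k) y₂    _       c = contradiction c ℕ.1+n≰n
  grid⇒⊑ (z k) (z l) (s≤s r) _ = z⊑z (ℕ.∸-cancelʳ-≤ (≤m l) r)

  least : ∀ p → x Fin.zero ⊑ p
  least (x i) = x⊑x z≤n
  least y₁    = x⊑y₁
  least y₂    = x⊑y₂
  least (z k) = x⊑z

  greatest : ∀ p → p ⊑ z Fin.zero
  greatest (x i) = x⊑z
  greatest y₁    = y₁⊑z
  greatest y₂    = y₂⊑z
  greatest (z k) = z⊑z z≤n

  -- With n = 2 + m this is (j + 1)(2n - j), the weight of both x_{j+1} and z_{j+1}.
  arm : ℕ → ℕ
  arm j = suc j * (4 + m + (m ∸ j))

  -- The coefficient of either spin node, `n (n + 1) / 2` in type D with `n + 1` nodes, where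
  -- `n = 2 + m`.
  spike : ℕ
  spike = triangular (2 + m)

  weight : ℕ → ℕ → ℕ
  weight zero          _       = 0
  weight (suc _)       zero    = 0
  weight (suc zero)    (suc j) =
    if does (j ℕ.≤? m) then arm j else if does (j ℕ.≟ suc m) then spike else 0
  weight (suc (suc i)) (suc j) =
    if does (j ℕ.≟ suc m)
    then if does (i ℕ.≤? m) then arm (m ∸ i) else 0
    else if does ((i ℕ.≟ 0) ×-dec (j ℕ.≟ m)) then spike else 0

  weight-x : ∀ {j} → j ≤ m → weight 1 (suc j) ≡ arm j
  weight-x {j} = if-yes (j ℕ.≤? m)

  weight-y₁ : weight 1 (2 + m) ≡ spike
  weight-y₁ = trans (if-no (suc m ℕ.≤? m) ℕ.1+n≰n) (if-yes (suc m ℕ.≟ suc m) refl)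

  weight-y₂ : weight 2 (suc m) ≡ spike
  weight-y₂ = trans (if-no (m ℕ.≟ suc m) (ℕ.1+n≢n ∘ sym)) (if-yes ((0 ℕ.≟ 0) ×-dec (m ℕ.≟ m)) (refl , refl))

  weight-z : ∀ {i} → i ≤ m → weight (2 + i) (2 + m) ≡ arm (m ∸ i)
  weight-z {i} i≤m = trans (if-yes (suc m ℕ.≟ suc m) refl) (if-yes (i ℕ.≤? m) i≤m)

  weight-above : weight (3 + m) (2 + m) ≡ 0
  weight-above = trans (if-yes (suc m ℕ.≟ suc m) refl) (if-no (suc m ℕ.≤? m) ℕ.1+n≰n)

  weight-off : ∀ i j → j ≢ suc m → (i ≡ 0 → j ≢ m) → weight (2 + i) (suc j) ≡ 0
  weight-off i j p q = trans (if-no (j ℕ.≟ suc m) p)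
    (if-no ((i ℕ.≟ 0) ×-dec (j ℕ.≟ m)) λ (i≡0 , j≡m) → q i≡0 j≡m)

  weight-right : ∀ i → weight (suc i) (3 + m) ≡ 0
  weight-right zero    = trans (if-no (2 + m ℕ.≤? m) (ℕ.1+n≰n ∘ ℕ.<⇒≤)) (if-no (2 + m ℕ.≟ suc m) ℕ.1+n≢n)
  weight-right (suc i) = weight-off i (2 + m) ℕ.1+n≢n λ _ p → ℕ.1+n≰n (ℕ.<⇒≤ (ℕ.≤-reflexive p))

  weight-left : ∀ i j → j ≤ m → weight (2 + i) j ≡ 0
  weight-left i zero    _   = refl
  weight-left i (suc j) j<m = weight-off i j (ℕ.<⇒≢ (ℕ.m≤n⇒m≤1+n j<m)) λ _ → ℕ.<⇒≢ j<m

  weight-inner : ∀ i → weight (3 + i) (suc m) ≡ 0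
  weight-inner i = weight-off (suc i) m (ℕ.1+n≢n ∘ sym) λ ()

  -- The neighbour on the arm away from the branch node, with 0 past the tip.
  previous : ℕ → ℕ
  previous zero    = 0
  previous (suc j) = arm j

  weight-x-previous : ∀ j → j ≤ m → weight 1 j ≡ previous j
  weight-x-previous zero    _   = refl
  weight-x-previous (suc j) j<m = weight-x (ℕ.<⇒≤ j<m)

  weight-z-previous : ∀ {i} → i ≤ m → weight (3 + i) (2 + m) ≡ previous (m ∸ i)
  weight-z-previous {i} i≤m with ℕ.m≤n⇒m<n∨m≡n i≤m
  ... | inj₁ i<m  = trans (weight-z i<m) (cong previous (sym (∸-step i<m)))
  ... | inj₂ refl = trans weight-above (cong previous (sym (ℕ.n∸n≡0 m)))

  weight-nonZero : ∀ p → NonZero (weight (suc (row p)) (suc (col p)))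
  weight-nonZero (x i) = subst NonZero (sym (weight-x (≤m i))) _
  weight-nonZero y₁    = subst NonZero (sym weight-y₁) _
  weight-nonZero y₂    = subst NonZero (sym weight-y₂) _
  weight-nonZero (z k) = subst NonZero (sym (weight-z (ℕ.m∸n≤m m (toℕ k)))) _

  support : ∀ i j → NonZero (weight i j) → ∃[ p ] (suc (row p) ≡ i × suc (col p) ≡ j)
  support (suc zero) (suc j) nz = first (j ℕ.≤? m) (j ℕ.≟ suc m) nz
    where
    first : ∀ {k l} (A? : Dec (j ≤ m)) (B? : Dec (j ≡ suc m)) →
            NonZero (if does A? then k else if does B? then l else 0) →
            ∃[ p ] (suc (row p) ≡ 1 × suc (col p) ≡ suc j)
    first (yes j≤m) _          _ = x (fromℕ< (s≤s j≤m)) , refl , cong suc (Fin.toℕ-fromℕ< (s≤s j≤m))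
    first (no _)    (yes refl) _ = y₁ , refl , refl
  support (suc (suc i)) (suc j) nz =
    other (j ℕ.≟ suc m) (i ℕ.≤? m) ((i ℕ.≟ 0) ×-dec (j ℕ.≟ m)) nz
    where
    other : ∀ {k l} (A? : Dec (j ≡ suc m)) (B? : Dec (i ≤ m)) (C? : Dec (i ≡ 0 × j ≡ m)) →
            NonZero (if does A? then if does B? then k else 0 else if does C? then l else 0) →
            ∃[ p ] (suc (row p) ≡ 2 + i × suc (col p) ≡ suc j)
    other (yes refl) (yes i≤m) _ _ =
      z (fromℕ< (s≤s (ℕ.m∸n≤m m i)))
      , cong (2 +_) (trans (cong (m ∸_) (Fin.toℕ-fromℕ< (s≤s (ℕ.m∸n≤m m i)))) (ℕ.m∸[m∸n]≡n i≤m))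
      , refl
    other (no _) _ (yes (refl , refl)) _ = y₂ , refl , refl

  lower : ∀ (p q : D) → row p ≤ row q → col p ≤ col q →
          (row p ≡ row q × col p ≡ col q) ⊎
          (row p < row q × NonZero (weight (row q) (suc (col q)))) ⊎
          (col p < col q × NonZero (weight (suc (row q)) (col q)))
  lower p (z k) r c with ℕ.m≤n⇒m<n∨m≡n r | ℕ.m≤n⇒m<n∨m≡n c
  ... | inj₁ r< | _        = inj₂ (inj₁ (r< , upward (m ∸ toℕ k) (ℕ.m∸n≤m m (toℕ k))))
    where
    upward : ∀ i → i ≤ m → NonZero (weight (suc i) (2 + m))
    upward zero    _   = weight-nonZero y₁
    upward (suc i) i<m = subst NonZero (sym (weight-z (ℕ.<⇒≤ i<m))) _
  ... | inj₂ r≡ | inj₂ c≡ = inj₁ (r≡ , c≡)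
  lower y₂ (z k) r c | inj₂ r≡ | inj₁ c< = inj₂ (inj₂ (c< ,
    subst (λ i → NonZero (weight (suc i) (suc m))) r≡ (weight-nonZero y₂)))
  lower y₁ (z k) r c | inj₂ () | inj₁ c<
  lower (x i) (z k) r c | inj₂ () | inj₁ c<
  lower (z l) (z k) r c | inj₂ r≡ | inj₁ c< = contradiction c< (ℕ.<-irrefl refl)
  lower p y₁ r c with ℕ.m≤n⇒m<n∨m≡n c
  ... | inj₁ c< = inj₂ (inj₂ (c< , subst NonZero (sym (weight-x ℕ.≤-refl)) _))
  lower y₁ y₁ r c | inj₂ _ = inj₁ (refl , refl)
  lower (x i) y₁ r c | inj₂ c≡ = inj₁ (refl , c≡)
  lower (x i) y₂ r c = inj₂ (inj₁ (s≤s z≤n , subst NonZero (sym (weight-x ℕ.≤-refl)) _))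
  lower y₁ y₂ r c = contradiction c ℕ.1+n≰n
  lower y₂ y₂ r c = inj₁ (refl , refl)
  lower (z k) y₂ r c = contradiction c ℕ.1+n≰n
  lower (x i) (x j) r c with ℕ.m≤n⇒m<n∨m≡n c
  ... | inj₁ c< = inj₂ (inj₂ (c< , leftward j c<))
    where
    leftward : ∀ {i} (j : Fin (suc m)) → i < toℕ j → NonZero (weight 1 (toℕ j))
    leftward (Fin.suc j) _ = subst NonZero (sym (weight-x (ℕ.<⇒≤ (Fin.toℕ<n j)))) _
  ... | inj₂ c≡ = inj₁ (refl , c≡)
  lower y₁ (x j) r c = contradiction (ℕ.≤-trans c (≤m j)) ℕ.1+n≰n

  absent : ∀ {n} {A : Set} → n ≡ 0 → NonZero n → A
  absent refl nz = contradiction refl (ℕ.≢-nonZero⁻¹ 0 {{nz}})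

  mesh : ∀ p → NonZero (weight (2 + row p) (col p)) →
         weight (1 + row p) (col p) ≡ weight (2 + row p) (1 + col p)
  mesh (x i) nz = absent (weight-left 0 (toℕ i) (≤m i)) nz
  mesh y₁    nz = trans (weight-x ℕ.≤-refl) (sym (weight-z z≤n))
  mesh y₂    nz = absent (weight-left 1 m ℕ.≤-refl) nz
  mesh (z k) nz = absent (weight-inner (m ∸ toℕ k)) nz

  -- The nodes of the arm before the branch node, whose weight is `arm m`; `k = 0` is the tip, with
  -- a single neighbour.
  arm-balance : ∀ k → k < m → previous k + arm (suc k) + 2 ≡ 2 * arm k
  arm-balance zero k<m = trans (identity m (m ∸ 1)) (cong (λ l → 2 * (1 * (4 + m + l))) (sym (∸-step k<m)))
    where
    identity : ∀ m l → 2 * (4 + m + l) + 2 ≡ 2 * (1 * (4 + m + suc l))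
    identity = solve-∀
  arm-balance (suc k) k<m rewrite ∸-step (ℕ.<⇒≤ k<m) | ∸-step k<m = identity m k (m ∸ (2 + k))
    where
    identity : ∀ m k l → suc k * (4 + m + suc (suc l)) + (3 + k) * (4 + m + l) + 2 ≡
                         2 * ((2 + k) * (4 + m + suc l))
    identity = solve-∀

  -- A spin node has the branch node as its only neighbour.
  spike-balance : arm m + 2 ≡ 2 * spike
  spike-balance = trans (cong (λ l → suc m * (4 + m + l) + 2) (ℕ.n∸n≡0 m))
    (trans (identity m) (sym (2*triangular (2 + m))))
    where
    identity : ∀ m → suc m * (4 + m + 0) + 2 ≡ (2 + m) * (3 + m)
    identity = solve-∀

  previous-m : previous m ≡ m * (5 + m)
  previous-m = helper m refl
    where
    helper : ∀ k → k ≡ m → previous k ≡ k * (5 + m)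
    helper zero    _    = refl
    helper (suc k) refl = cong (suc k *_) (trans (cong (4 + m +_) (ℕ.m+n∸n≡m 1 k)) (ℕ.+-comm (4 + m) 1))

  -- The branch node is adjacent to the preceding node of the arm, if any, and to both spin nodes.
  end-balance : previous m + spike + spike + 2 ≡ 2 * arm m
  end-balance = begin
    previous m + spike + spike + 2         ≡⟨ cong (λ l → l + spike + spike + 2) previous-m ⟩
    m * (5 + m) + spike + spike + 2        ≡⟨ double m spike ⟩
    m * (5 + m) + 2 * spike + 2            ≡⟨ cong (λ l → m * (5 + m) + l + 2) (2*triangular (2 + m)) ⟩
    m * (5 + m) + (2 + m) * (3 + m) + 2    ≡⟨ identity m ⟩
    2 * (suc m * (4 + m + 0))              ≡⟨ cong (λ l → 2 * (suc m * (4 + m + l))) (ℕ.n∸n≡0 m) ⟨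
    2 * arm m                              ∎
    where
    open ≡-Reasoning
    double : ∀ m s → m * (5 + m) + s + s + 2 ≡ m * (5 + m) + 2 * s + 2
    double = solve-∀
    identity : ∀ m → m * (5 + m) + (2 + m) * (3 + m) + 2 ≡ 2 * (suc m * (4 + m + 0))
    identity = solve-∀

  Balanced : ℕ → ℕ → Set
  Balanced i j =
    (coefficient (weight (2 + i) j) (weight (1 + i) j) (weight (2 + i) (1 + j)) +
     coefficient (weight i (2 + j)) (weight i (1 + j)) (weight (1 + i) (2 + j))) + 2
    ≡ 2 * weight (1 + i) (1 + j)

  balance-x : ∀ j → j ≤ m → Balanced 0 j
  balance-x j j≤m with ℕ.m≤n⇒m<n∨m≡n j≤m
  ... | inj₁ j<m
    rewrite weight-left 0 j j≤m | weight-x-previous j j≤m | weight-left 0 (suc j) j<m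
          | weight-x j<m | weight-x j≤m | ℕ.+-identityʳ (previous j) = arm-balance j j<m
  ... | inj₂ refl
    rewrite weight-left 0 m j≤m | weight-x-previous m j≤m | weight-y₂ | weight-y₁ | weight-x j≤m = end-balance

  balance-z : ∀ i → i ≤ m → Balanced (suc i) (suc m)
  balance-z zero i≤m
    rewrite weight-inner 0 | weight-y₂ | weight-z-previous i≤m | weight-right 0 | weight-right 1 | weight-y₁
          | weight-z i≤m = trans (rearrange (previous m) spike) end-balance
    where
    rearrange : ∀ p s → s + p + (s + 0) + 2 ≡ p + s + s + 2
    rearrange = solve-∀
  balance-z (suc i) i<m
    rewrite weight-inner (suc i) | weight-inner i | weight-z-previous i<m | weight-right (suc i)
          | weight-right (2 + i) | weight-z (ℕ.<⇒≤ i<m) | weight-z i<m | ∸-step i<m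
          | ℕ.+-identityʳ (arm (suc (m ∸ suc i))) = arm-balance (m ∸ suc i)
            (ℕ.≤-trans (ℕ.≤-reflexive (sym (∸-step i<m))) (ℕ.m∸n≤m m i))

  balance : ∀ p → Balanced (row p) (col p)
  balance (x i) = balance-x (toℕ i) (≤m i)
  balance y₁ rewrite weight-y₂ | weight-y₁ | weight-right 0 | weight-z {0} z≤n = trans
    (cong (_+ 2) (ℕ.+-identityʳ (arm m))) spike-balance
  balance y₂ rewrite weight-left 1 m ℕ.≤-refl | weight-left 0 m ℕ.≤-refl | weight-inner 0
    | weight-y₁ | weight-y₂ | weight-z {0} z≤n = spike-balance
  balance (z k) = balance-z (m ∸ toℕ k) (ℕ.m∸n≤m m (toℕ k))

-- The exceptional posets, checked by evaluation

module Tabulated {m n} (roots : Vec (Vec ℕ m) (suc n)) (rows cols weights : Vec ℕ (suc n)) where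

  row col : Fin (suc n) → ℕ
  row = lookup rows
  col = lookup cols

  at? : ∀ i j → Dec (∃[ x ] (suc (row x) ≡ i × suc (col x) ≡ j))
  at? i j = Fin.any? λ x → (_ ℕ.≟ i) ×-dec (_ ℕ.≟ j)

  weight : ℕ → ℕ → ℕ
  weight i j with at? i j
  ... | yes (x , _) = lookup weights x
  ... | no _        = 0

  weight-support : ∀ i j → NonZero (weight i j) → ∃[ x ] (suc (row x) ≡ i × suc (col x) ≡ j)
  weight-support i j nz with at? i j
  ... | yes p = p

  _≼_ : Fin (suc n) → Fin (suc n) → Set
  x ≼ y = Pointwise _≤_ (lookup roots x) (lookup roots y)

  _≼?_ : ∀ x y → Dec (x ≼ y)
  x ≼? y = decidable ℕ._≤?_ (lookup roots x) (lookup roots y)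

  bottom top : Fin (suc n)
  bottom = Fin.zero
  top    = Fin.fromℕ n

  order? : Dec (∀ x y → (x ≼ y → row x ≤ row y × col x ≤ col y) × (row x ≤ row y × col x ≤ col y → x ≼ y))
  order? = Fin.all? λ x → Fin.all? λ y →
    (x ≼? y →-dec (_ ℕ.≤? _) ×-dec (_ ℕ.≤? _)) ×-dec (((_ ℕ.≤? _) ×-dec (_ ℕ.≤? _)) →-dec x ≼? y)

  lower? : Dec (∀ x y → row x ≤ row y → col x ≤ col y →
    (row x ≡ row y × col x ≡ col y) ⊎
    (row x < row y × NonZero (weight (row y) (suc (col y)))) ⊎
    (col x < col y × NonZero (weight (suc (row y)) (col y))))
  lower? = Fin.all? λ x → Fin.all? λ y → (_ ℕ.≤? _) →-dec (_ ℕ.≤? _) →-dec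
    (((_ ℕ.≟ _) ×-dec (_ ℕ.≟ _)) ⊎-dec
     ((_ ℕ.<? _) ×-dec ℕ.nonZero? _) ⊎-dec
     ((_ ℕ.<? _) ×-dec ℕ.nonZero? _))

  weights? : Dec (∀ x → let i = row x; j = col x in
    NonZero (weight (suc i) (suc j)) ×
    (NonZero (weight (2 + i) j) → weight (1 + i) j ≡ weight (2 + i) (1 + j)) ×
    (coefficient (weight (2 + i) j) (weight (1 + i) j) (weight (2 + i) (1 + j)) +
     coefficient (weight i (2 + j)) (weight i (1 + j)) (weight (1 + i) (2 + j))) + 2
    ≡ 2 * weight (1 + i) (1 + j))
  weights? = Fin.all? λ x →
    ℕ.nonZero? _ ×-dec (ℕ.nonZero? _ →-dec (_ ℕ.≟ _)) ×-dec (_ ℕ.≟ _)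

  extremes? : Dec ((∀ x → (bottom ≼ x) × (x ≼ top)) ×
    weight (suc (row top)) (suc (col top)) ≡ weight (suc (row bottom)) (suc (col bottom)))
  extremes? = Fin.all? (λ x → (bottom ≼? x) ×-dec (x ≼? top)) ×-dec (_ ℕ.≟ _)

  -- Every condition is decidable over a finite index set. For closed tables the `True` arguments
  -- compute to the unit type and are filled in by inference, so a wrong entry would be a type
  -- error.
  drawing : {True order?} → {True lower?} → {True weights?} → {True extremes?} →
            Drawing (On.poset (vecPoset m) (lookup roots))
  drawing {o} {l} {w} {e} = record
    { row            = row
    ; col            = col
    ; ≤⇒grid         = λ {x} {y} → proj₁ (toWitness o x y)
    ; grid⇒≤         = λ {x} {y} p q → proj₂ (toWitness o x y) (p , q)
    ; weight         = weight
    ; weight-nonZero = λ x → proj₁ (toWitness w x)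
    ; weight-support = weight-support
    ; lower          = toWitness l
    ; mesh           = λ x → proj₁ (proj₂ (toWitness w x))
    ; balance        = λ x → proj₂ (proj₂ (toWitness w x))
    ; bottom         = bottom
    ; top            = top
    ; least          = λ x → proj₁ (proj₁ (toWitness e) x)
    ; greatest       = λ x → proj₂ (proj₁ (toWitness e) x)
    ; symmetric      = proj₂ (toWitness e)
    }

-- `row + col` is the height of the root minus one. Over the nodes 1 to 6, 2ρ^∨ has the coefficients
-- 16, 22, 30, 42, 30, 16; each element takes that of its heap label, which need not be the simple
-- root added in a step up to it.
drawΛE₆ : Drawing ΛE₆
drawΛE₆ = Tabulated.drawing E₆-roots
  (0 ∷ 1 ∷ 2 ∷ 3 ∷ 2 ∷ 3 ∷ 2 ∷ 4 ∷ 3 ∷ 5 ∷ 4 ∷ 5 ∷ 4 ∷ 5 ∷ 6 ∷ 7 ∷ [])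
  (0 ∷ 0 ∷ 0 ∷ 0 ∷ 1 ∷ 1 ∷ 2 ∷ 1 ∷ 2 ∷ 1 ∷ 2 ∷ 2 ∷ 3 ∷ 3 ∷ 3 ∷ 3 ∷ [])
  (16 ∷ 30 ∷ 42 ∷ 22 ∷ 30 ∷ 42 ∷ 16 ∷ 30 ∷ 30 ∷ 16 ∷ 42 ∷ 30 ∷ 22 ∷ 42 ∷ 30 ∷ 16 ∷ [])

-- Over the nodes 1 to 7 the coefficients are 34, 49, 66, 96, 75, 52, 27; bottom and top both carry
-- the label 7, since -w₀ is the identity in this type.
drawΛE₇ : Drawing ΛE₇
drawΛE₇ = Tabulated.drawing E₇-roots
  (0 ∷ 1 ∷ 2 ∷ 3 ∷ 4 ∷ 3 ∷ 3 ∷ 4 ∷ 4 ∷ 5 ∷ 5 ∷ 6 ∷ 5 ∷ 6 ∷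
   7 ∷ 6 ∷ 7 ∷ 6 ∷ 7 ∷ 6 ∷ 7 ∷ 7 ∷ 8 ∷ 8 ∷ 9 ∷ 10 ∷ 11 ∷ [])
  (0 ∷ 0 ∷ 0 ∷ 0 ∷ 0 ∷ 1 ∷ 2 ∷ 1 ∷ 2 ∷ 1 ∷ 2 ∷ 1 ∷ 3 ∷ 2 ∷
   1 ∷ 3 ∷ 2 ∷ 4 ∷ 3 ∷ 5 ∷ 4 ∷ 5 ∷ 4 ∷ 5 ∷ 5 ∷ 5 ∷ 5 ∷ [])
  (27 ∷ 52 ∷ 75 ∷ 96 ∷ 49 ∷ 66 ∷ 34 ∷ 96 ∷ 66 ∷ 75 ∷ 96 ∷ 52 ∷ 49 ∷ 75 ∷
   27 ∷ 96 ∷ 52 ∷ 66 ∷ 75 ∷ 34 ∷ 96 ∷ 66 ∷ 49 ∷ 96 ∷ 75 ∷ 52 ∷ 27 ∷ [])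

theorem3p21 : ∀ {a ℓ₁ ℓ₂} (K : CharZeroField a ℓ₁ ℓ₂) (P : FinitePoset) → IsMinuscule P →
    let open CharZeroField K
        open Statistics K P
    in ∑ 𝟙 ≋ constant (fromℕ (FinitePoset.size P) /2)
theorem3p21 K P minuscule = HalfWeights.∑𝟙≋half K P (draw minuscule)
  where
  draw : IsMinuscule P → Drawing (FinitePoset.poset P)
  draw (isRectangle a b P≅Q)                              = pullback {P} P≅Q (drawRectangle a b)
  draw (isShiftedStaircase n P≅Q)                         = pullback {P} P≅Q (drawStaircase n)
  draw (isDoubleTailedDiamond (suc (suc m)) (s≤s _) P≅Q)  = pullback {P} P≅Q (drawDoubleTailedDiamond m)
  draw (isΛE₆ P≅Q)                                        = pullback {P} P≅Q drawΛE₆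
  draw (isΛE₇ P≅Q)                                        = pullback {P} P≅Q drawΛE₇
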